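{- Let $G$ be a finite abelian group and $t$ an integer relatively prime to $|G|$. Let $X\in \mathbb{Z}[G]$ satisfy $X^{(t)}=X$, $|X|=n$ and $XX^{(-1)}=n^2$ for some integer $n\geq 1$, and let $a_0$ be the coefficient of the identity in $X$. Suppose that for every prime divisor $q$ of $|G|$ at least one of the following holds: (1) $\operatorname{ord}_q(t)>\max\{n,n-a_0\}$; (2) $\operatorname{ord}_q(t)\geq n$ and $\operatorname{ord}_q(t)$ is even. Then $X=n$.
   Context: For $X=\sum_g x_g g\in\mathbb{Z}[G]$ and an integer $s$, $X^{(s)}=\sum_g x_g g^s$ and $|X|=\sum_g x_g$. $\operatorname{ord}_q(t)$ is the multiplicative order of $t$ modulo $q$. -}

module Defs where

open import Level using (0ℓ)
open import Algebra.Bundles using (AbelianGroup)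
open import Data.Nat as ℕ using (ℕ; zero; suc)
open import Data.Fin using (Fin; zero; suc)
open import Data.Integer as ℤ using (ℤ; +_; -[1+_])
import Data.Integer.Divisibility as ℤDiv
open import Data.Product using (∃; _×_)
open import Relation.Binary.PropositionalEquality using (_≡_)
open import Relation.Binary.Definitions using (Decidable)
open import Relation.Nullary using (¬_; yes; no)

record FinAbGroup : Set₁ where
  field
    abGroup   : AbelianGroup 0ℓ 0ℓ
  open AbelianGroup abGroup public
  field
    _≟_       : Decidable _≈_
    size      : ℕ
    enum      : Fin size → Carrier
    enum-surj : ∀ (g : Carrier) → ∃ λ i → enum i ≈ g
    enum-inj  : ∀ (i j : Fin size) → enum i ≈ enum j → i ≡ j

sumℤ : ∀ {m} → (Fin m → ℤ) → ℤ
sumℤ {zero}  f = + 0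
sumℤ {suc m} f = f zero ℤ.+ sumℤ (λ i → f (suc i))

module _ (F : FinAbGroup) where
  open FinAbGroup F

  -- Elements of the group ring ℤ[G]: X = Σ_i x_i · enum i,
  -- represented by the coefficient function i ↦ x_i.
  ZG : Set
  ZG = Fin size → ℤ

  _≡ᴳ_ : ZG → ZG → Set
  X ≡ᴳ Y = ∀ i → X i ≡ Y i

  δ : Carrier → Carrier → ℤ
  δ g h with g ≟ h
  ... | yes _ = + 1
  ... | no  _ = + 0

  powℕ : Carrier → ℕ → Carrier
  powℕ g zero    = ε
  powℕ g (suc k) = g ∙ powℕ g k

  powℤ : Carrier → ℤ → Carrier
  powℤ g (+ k)      = powℕ g k
  powℤ g -[1+ k ]   = (powℕ g (suc k)) ⁻¹

  -- X^{(s)} = Σ_h x_h h^s ; coefficient at g is Σ_{h : h^s = g} x_h.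
  twist : ℤ → ZG → ZG
  twist s X i = sumℤ (λ j → X j ℤ.* δ (powℤ (enum j) s) (enum i))

  mul : ZG → ZG → ZG
  mul X Y i = sumℤ (λ j → sumℤ (λ k → X j ℤ.* Y k ℤ.* δ (enum j ∙ enum k) (enum i)))

  aug : ZG → ℤ
  aug X = sumℤ X

  scalar : ℤ → ZG
  scalar m i = m ℤ.* δ (enum i) ε

  coeff1 : ZG → ℤ
  coeff1 X = sumℤ (λ i → X i ℤ.* δ (enum i) ε)

IsOrd : ℕ → ℤ → ℕ → Set
IsOrd q t k =
  (1 ℕ.≤ k) × ((+ q) ℤDiv.∣ (t ℤ.^ k ℤ.- + 1))
  × (∀ j → 1 ℕ.≤ j → (+ q) ℤDiv.∣ (t ℤ.^ j ℤ.- + 1) → k ℕ.≤ j)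

{-# OPTIONS --safe #-}
-- Put Y_m = X^(m); every Y_m satisfies the same three identities as X. Let e(m) = n - (coefficient of 1 in Y_m).
-- The coefficients of Y_m have sum n and sum of squares n², so 0 ≤ e(m) < 2n, while e(|G|) = 0.
-- For a prime q dividing |G| with k = ord_q(t), e(m) - e(mq) is the sum of the coefficients of Y_m at the
-- elements of order q. These form t-orbits of length k ≥ n, so e(m) and e(mq) are equal or differ by exactly k.
-- Running through the prime factors of |G| in decreasing order of k, it follows that e(m) is 0 or one of the k's.
-- Suppose e(1) = k ≠ 0. Condition (1) excludes this, so k is even. Let m be the product of the prime factors of |G| with
-- order different from k; then still e(m) = k, and some power of t is -1 modulo |G|/m, so that Y_m^(-1) = Y_m.
-- Then n² = Y_m² ≡ Y_m^(2) modulo 2, so that the coefficients of Y_m off the identity are even (|G| is odd). The differences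
-- e(m') - e(m'q) are now multiples of 2k for the remaining factors, hence 0, and e(m) = e(|G|) = 0, a contradiction.

module Submission where

open import Defs
open import Algebra.Bundles using (AbelianGroup)
import Algebra.Properties.AbelianGroup
open import Data.Empty using (⊥-elim)
open import Data.Fin as Fin using (Fin; zero; suc; toℕ)
open import Data.Fin.Permutation using (Permutation′; permutation; _⟨$⟩ʳ_)
import Data.Fin.Properties as Finₚ
open import Data.Integer as ℤ using (ℤ; +_; -[1+_]; ∣_∣; _+_; _*_; -_; _-_)
open import Data.Integer.Divisibility.Signed as ℤ∣ using (divides)
import Data.Integer.DivMod as ℤDM
import Data.Integer.Properties as ℤₚ
open import Data.Integer.Tactic.RingSolver using (solve-∀)
open import Data.List using (List; []; _∷_; _++_; allFin; map)
open import Data.List.Membership.Propositional using (_∈_)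
open import Data.List.Membership.Propositional.Properties using (∈-allFin)
open import Data.List.Properties using (map-++)
open import Data.List.Relation.Binary.Permutation.Propositional.Properties using (∈-resp-↭; map⁺)
open import Data.List.Relation.Unary.All as All using (All; []; _∷_)
import Data.List.Relation.Unary.All.Properties as Allₚ
open import Data.List.Relation.Unary.AllPairs using (AllPairs; []; _∷_)
open import Data.List.Relation.Unary.Any using (here; there)
open import Data.List.Relation.Unary.Linked.Properties using (Linked⇒AllPairs)
import Data.List.Sort as Sort
open import Data.Nat as ℕ using (ℕ; zero; suc; z≤n; s≤s; NonZero)
open import Data.Nat.Coprimality as Coprimality using (Coprime)
open import Data.Nat.Divisibility as ℕ∣ using (_∣_)
import Data.Nat.DivMod as ℕDM
open import Data.Nat.GCD using (module Bézout)
open import Data.Nat.GeneralisedArithmetic using (fold)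
open import Data.Nat.Induction using (<-rec)
open import Data.Nat.ListAction using (product)
open import Data.Nat.ListAction.Properties using (∈⇒∣product; product-++; product-↭)
open import Data.Nat.Primality using (Prime; euclidsLemma; prime?; prime⇒irreducible; prime⇒nonZero; ¬prime[1])
open import Data.Nat.Primality.Factorisation using (factorise; module PrimeFactorisation)
import Data.Nat.Properties as ℕₚ
open import Data.Product using (∃; _×_; _,_; proj₁; proj₂)
open import Data.Sum using (_⊎_; inj₁; inj₂; [_,_]′)
open import Function using (_∘_; id)
import Relation.Binary.Construct.Flip.EqAndOrd as Flip
import Relation.Binary.Construct.On as On
open import Relation.Binary.PropositionalEquality hiding (setoid)
open import Relation.Nullary using (¬_; Dec; yes; no; ¬?; _×-dec_)
open import Relation.Nullary.Decidable using (toWitness)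
open import Relation.Unary using (Decidable)
open Algebra.Properties.AbelianGroup ℤₚ.+-0-abelianGroup using () renaming (∙-cancelʳ to +-cancelʳ)

-- Indicators of decidable propositions and finite integer sums.

⟦_⟧ : ∀ {P : Set} → Dec P → ℤ
⟦ yes _ ⟧ = + 1
⟦ no  _ ⟧ = + 0

⟦⟧-cong : ∀ {P Q : Set} → (P → Q) → (Q → P) → (p : Dec P) (q : Dec Q) → ⟦ p ⟧ ≡ ⟦ q ⟧
⟦⟧-cong f g (yes _) (yes _) = refl
⟦⟧-cong f g (yes a) (no ¬b) = ⊥-elim (¬b (f a))
⟦⟧-cong f g (no ¬a) (yes b) = ⊥-elim (¬a (g b))
⟦⟧-cong f g (no _)  (no _)  = refl

⟦⟧-yes : ∀ {P : Set} (p : Dec P) → P → ⟦ p ⟧ ≡ + 1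
⟦⟧-yes (yes _) a = refl
⟦⟧-yes (no ¬a) a = ⊥-elim (¬a a)

⟦⟧-no : ∀ {P : Set} (p : Dec P) → ¬ P → ⟦ p ⟧ ≡ + 0
⟦⟧-no (yes a) ¬a = ⊥-elim (¬a a)
⟦⟧-no (no _)  ¬a = refl

[_≟_] : ∀ {m} → Fin m → Fin m → ℤ
[ i ≟ j ] = ⟦ i Fin.≟ j ⟧

[≟]-sym : ∀ {m} (i j : Fin m) → [ i ≟ j ] ≡ [ j ≟ i ]
[≟]-sym i j = ⟦⟧-cong sym sym (i Fin.≟ j) (j Fin.≟ i)

sum-cong : ∀ {m} {f g : Fin m → ℤ} → f ≗ g → sumℤ f ≡ sumℤ g
sum-cong {zero}  e = refl
sum-cong {suc m} e = cong₂ _+_ (e zero) (sum-cong (e ∘ suc))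

sum-0 : ∀ {m} → sumℤ {m} (λ _ → + 0) ≡ + 0
sum-0 {zero}  = refl
sum-0 {suc m} = trans (ℤₚ.+-identityˡ _) (sum-0 {m})

sum-1 : ∀ m → sumℤ {m} (λ _ → + 1) ≡ + m
sum-1 zero    = refl
sum-1 (suc m) = cong (_+_ (+ 1)) (sum-1 m)

sum-+ : ∀ {m} (f g : Fin m → ℤ) → sumℤ (λ i → f i + g i) ≡ sumℤ f + sumℤ g
sum-+ {zero}  f g = refl
sum-+ {suc m} f g = trans (cong (_+_ (f zero + g zero)) (sum-+ (f ∘ suc) (g ∘ suc))) (lem (f zero) (g zero) _ _)
  where
  lem : ∀ a b c d → a + b + (c + d) ≡ a + c + (b + d)
  lem = solve-∀

sum-*ˡ : ∀ {m} c (f : Fin m → ℤ) → sumℤ (λ i → c * f i) ≡ c * sumℤ f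
sum-*ˡ {zero}  c f = sym (ℤₚ.*-zeroʳ c)
sum-*ˡ {suc m} c f = trans (cong (_+_ (c * f zero)) (sum-*ˡ c (f ∘ suc))) (sym (ℤₚ.*-distribˡ-+ c _ _))

sum-*ʳ : ∀ {m} c (f : Fin m → ℤ) → sumℤ (λ i → f i * c) ≡ sumℤ f * c
sum-*ʳ c f = trans (sum-cong (λ i → ℤₚ.*-comm (f i) c)) (trans (sum-*ˡ c f) (ℤₚ.*-comm c _))

sum-neg : ∀ {m} (f : Fin m → ℤ) → sumℤ (λ i → - f i) ≡ - sumℤ f
sum-neg f = trans (sum-cong (λ i → sym (ℤₚ.-1*i≡-i (f i)))) (trans (sum-*ˡ (- (+ 1)) f) (ℤₚ.-1*i≡-i _))

sum-swap : ∀ {m n} (f : Fin m → Fin n → ℤ) →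
           sumℤ (λ i → sumℤ (f i)) ≡ sumℤ (λ j → sumℤ (λ i → f i j))
sum-swap {zero} {n} f = sym (sum-0 {n})
sum-swap {suc m}  f = trans (cong (_+_ (sumℤ (f zero))) (sum-swap (f ∘ suc)))
                            (sym (sum-+ (f zero) (λ j → sumℤ (λ i → f (suc i) j))))

sum-pick : ∀ {m} (f : Fin m → ℤ) i → sumℤ (λ j → f j * [ i ≟ j ]) ≡ f i
sum-pick {suc m} f zero = trans (cong₂ _+_ (ℤₚ.*-identityʳ (f zero))
    (trans (sum-cong (λ j → ℤₚ.*-zeroʳ (f (suc j)))) (sum-0 {m}))) (ℤₚ.+-identityʳ _)
sum-pick {suc m} f (suc i) = trans (cong₂ _+_ (ℤₚ.*-zeroʳ (f zero))
    (trans (sum-cong (λ j → cong (f (suc j) *_)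
       (⟦⟧-cong Finₚ.suc-injective (cong suc) (suc i Fin.≟ suc j) (i Fin.≟ j))))
       (sum-pick (f ∘ suc) i))) (ℤₚ.+-identityˡ _)

sum-≥0 : ∀ {m} (f : Fin m → ℤ) → (∀ i → + 0 ℤ.≤ f i) → + 0 ℤ.≤ sumℤ f
sum-≥0 {zero}  f p = ℤₚ.≤-refl
sum-≥0 {suc m} f p = ℤₚ.+-mono-≤ (p zero) (sum-≥0 (f ∘ suc) (p ∘ suc))

term≤sum : ∀ {m} (f : Fin m → ℤ) → (∀ i → + 0 ℤ.≤ f i) → ∀ i → f i ℤ.≤ sumℤ f
term≤sum f p zero = subst (ℤ._≤ sumℤ f) (ℤₚ.+-identityʳ (f zero))
  (ℤₚ.+-monoʳ-≤ (f zero) (sum-≥0 (f ∘ suc) (p ∘ suc)))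
term≤sum f p (suc i) = subst (ℤ._≤ sumℤ f) (ℤₚ.+-identityˡ (f (suc i)))
  (ℤₚ.+-mono-≤ (p zero) (term≤sum (f ∘ suc) (p ∘ suc) i))

-- Deleting the term at `i` leaves nonnegative terms with sum 0, and each of them is at most that
-- sum.
others-vanish : ∀ {m} (f : Fin m → ℤ) → (∀ i → + 0 ℤ.≤ f i) →
                ∀ i → sumℤ f ≡ f i → ∀ j → i ≢ j → f j ≡ + 0
others-vanish f p i e j i≢j = ℤₚ.≤-antisym
    (subst₂ ℤ._≤_ (gj j i≢j) sum-g (term≤sum g g≥0 j)) (p j)
  where
  g : _ → ℤ
  g j = f j - f j * [ i ≟ j ]
  gj : ∀ j → i ≢ j → g j ≡ f j
  gj j i≢j rewrite ⟦⟧-no (i Fin.≟ j) i≢j | ℤₚ.*-zeroʳ (f j) = ℤₚ.+-identityʳ (f j)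
  g≥0 : ∀ j → + 0 ℤ.≤ g j
  g≥0 j with i Fin.≟ j
  ... | yes _ = ℤₚ.≤-reflexive (sym (trans (cong (λ z → f j - z) (ℤₚ.*-identityʳ (f j))) (ℤₚ.+-inverseʳ (f j))))
  ... | no  _ = subst (+ 0 ℤ.≤_) (sym (trans (cong (λ z → f j - z) (ℤₚ.*-zeroʳ (f j))) (ℤₚ.+-identityʳ (f j)))) (p j)
  sum-g : sumℤ g ≡ + 0
  sum-g = trans (sum-+ f _) (trans (cong₂ _+_ e (trans (sum-neg (λ j → f j * [ i ≟ j ])) (cong -_ (sum-pick f i)))) (ℤₚ.+-inverseʳ (f i)))

-- Off-diagonal terms occur in equal pairs. The induction strips the first row and the first column,
-- whose remaining entries have the same sum `r`.
symmetric-sum-parity : ∀ {m} (a : Fin m → Fin m → ℤ) → (∀ i j → a i j ≡ a j i) →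
  ∃ λ c → sumℤ (λ i → sumℤ (a i)) ≡ sumℤ (λ i → a i i) + c * + 2
symmetric-sum-parity {zero}  a s = + 0 , refl
symmetric-sum-parity {suc m} a s = r + c ,
  trans (cong (_+_ (a zero zero + r))
          (trans (sum-+ (λ i → a (suc i) zero) (λ i → sumℤ (λ j → a (suc i) (suc j))))
                 (cong₂ _+_ (sum-cong (λ i → s (suc i) zero)) (proj₂ ih))))
        (lem (a zero zero) r _ c)
  where
  r = sumℤ (λ j → a zero (suc j))
  ih = symmetric-sum-parity (λ i j → a (suc i) (suc j)) (λ i j → s (suc i) (suc j))
  c = proj₁ ih
  lem : ∀ x r d c → x + r + (r + (d + c * + 2)) ≡ x + d + (r + c) * + 2
  lem = solve-∀

-- Both sides are f 0 + ... + f k; the form without subtraction suits the induction.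
sum-shift : ∀ k (f : ℕ → ℤ) →
  sumℤ {k} (λ j → f (suc (toℕ j))) + f 0 ≡ sumℤ {k} (λ j → f (toℕ j)) + f k
sum-shift zero    f = refl
sum-shift (suc k) f = begin
  f 1 + S₂ + f 0              ≡⟨ cong (_+ f 0) (ℤₚ.+-comm (f 1) S₂) ⟩
  S₂ + f 1 + f 0              ≡⟨ cong (_+ f 0) (sum-shift k (f ∘ suc)) ⟩
  S₁ + f (suc k) + f 0        ≡⟨ lem S₁ (f (suc k)) (f 0) ⟩
  f 0 + S₁ + f (suc k)        ∎
  where
  open ≡-Reasoning
  S₂ = sumℤ {k} (λ j → f (suc (suc (toℕ j))))
  S₁ = sumℤ {k} (λ j → f (suc (toℕ j)))
  lem : ∀ a b c → a + b + c ≡ c + a + b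
  lem = solve-∀

-- Orbits of an injective map on a finite set.

fold-injective : ∀ {A : Set} (σ : A → A) → (∀ {x y} → σ x ≡ σ y → x ≡ y) →
  ∀ j {x y} → fold x σ j ≡ fold y σ j → x ≡ y
fold-injective σ inj zero    e = e
fold-injective σ inj (suc j) e = fold-injective σ inj j (inj e)

module Orbits {m k} (σ : Fin m → Fin m) (σ-inj : ∀ {x y} → σ x ≡ σ y → x ≡ y) (1≤k : 1 ℕ.≤ k) where

  OrbitsOfLength-k : (Fin m → ℤ) → Set
  OrbitsOfLength-k w = ∀ x → w x ≢ + 0 →
    fold x σ k ≡ x × (∀ j → 1 ℕ.≤ j → j ℕ.< k → fold x σ j ≢ x)

  module _ (i : Fin m) where
    -- Counts the visits among the first `k` iterates of `i`; once the orbit of `i` has length `k`,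
    -- this is its indicator.
    orbit : Fin m → ℤ
    orbit x = sumℤ {k} (λ j → [ fold i σ (toℕ j) ≟ x ])

    sum-orbit : sumℤ orbit ≡ + k
    sum-orbit = trans (sum-swap {n = k} (λ x j → [ fold i σ (toℕ j) ≟ x ])) (trans (sum-cong {k} (λ j → trans
      (sum-cong (λ x → sym (ℤₚ.*-identityˡ [ fold i σ (toℕ j) ≟ x ])))
      (sum-pick (λ _ → + 1) (fold i σ (toℕ j))))) (sum-1 k))

    -- By injectivity, iterate j + 1 hits `σ x` exactly when iterate j hits `x`. Shifting the index
    -- trades the term at 0 for the term at `k`, and these agree by `cyc`.
    orbit-σ : fold i σ k ≡ i → ∀ x → orbit (σ x) ≡ orbit x
    orbit-σ cyc x = +-cancelʳ (f 0) _ _ (begin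
      sumℤ {k} (λ j → f (toℕ j)) + f 0       ≡⟨ cong (λ z → orbit (σ x) + [ z ≟ σ x ]) (sym cyc) ⟩
      sumℤ {k} (λ j → f (toℕ j)) + f k       ≡⟨ sum-shift k f ⟨
      sumℤ {k} (λ j → f (suc (toℕ j))) + f 0 ≡⟨ cong (_+ f 0) (sum-cong {k} λ j →
                 ⟦⟧-cong σ-inj (cong σ) (_ Fin.≟ _) (_ Fin.≟ _)) ⟩
      orbit x + f 0 ∎)
      where
      open ≡-Reasoning
      f : ℕ → ℤ
      f j = [ fold i σ j ≟ σ x ]

  fold-invariant : (w : Fin m → ℤ) → (∀ x → w (σ x) ≡ w x) → ∀ i j → w (fold i σ j) ≡ w i
  fold-invariant w inv i zero    = refl
  fold-invariant w inv i (suc j) = trans (inv _) (fold-invariant w inv i j)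

  -- Peels off one orbit at a time: subtracting w i on the orbit of i changes the sum by k * w i.
  peel : (l : List (Fin m)) (w : Fin m → ℤ) → (∀ x → w (σ x) ≡ w x) → OrbitsOfLength-k w →
    (∀ x → w x ≢ + 0 → x ∈ l) → (+ k) ℤ∣.∣ sumℤ w
  peel [] w inv len sup = divides (+ 0) (trans (sum-cong w≡0) (sum-0 {m}))
    where
    w≡0 : ∀ x → w x ≡ + 0
    w≡0 x with w x ℤ.≟ + 0
    ... | yes e = e
    ... | no ne with () ← sup x ne
  peel (i ∷ l) w inv len sup with w i ℤ.≟ + 0
  ... | yes e = peel l w inv len sup′
    where
    sup′ : ∀ x → w x ≢ + 0 → x ∈ l
    sup′ x ne with sup x ne
    ... | here refl = ⊥-elim (ne e)
    ... | there x∈l = x∈l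
  ... | no  wi≢0 = subst ((+ k) ℤ∣.∣_) (trans (cong (_+ w i * + k) sum-w′) (lem _ _))
                    (ℤ∣.∣m∣n⇒∣m+n (peel l w′ inv′ len′ sup′) (divides (w i) refl))
    where
    cyc = proj₁ (len i wi≢0)
    w′ : Fin m → ℤ
    w′ x = w x - w i * orbit i x
    lem : ∀ a b → a - b + b ≡ a
    lem = solve-∀
    sum-w′ : sumℤ w′ ≡ sumℤ w - w i * + k
    sum-w′ = trans (sum-+ w _) (cong (_+_ (sumℤ w)) (trans (sum-neg (λ x → w i * orbit i x))
      (cong -_ (trans (sum-*ˡ (w i) (orbit i)) (cong (w i *_) (sum-orbit i))))))
    inv′ : ∀ x → w′ (σ x) ≡ w′ x
    inv′ x = cong₂ (λ a b → a - w i * b) (inv x) (orbit-σ i cyc x)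
    -- `w` is constant and nonzero on the orbit of `i`, so a zero `x` of `w` is never visited and
    -- nothing is subtracted there.
    w≡0⇒w′≡0 : ∀ x → w x ≡ + 0 → w′ x ≡ + 0
    w≡0⇒w′≡0 x wx = cong₂ _-_ wx (trans (cong (w i *_) (trans (sum-cong {k} (λ j →
       ⟦⟧-no (fold i σ (toℕ j) Fin.≟ x)
         (λ e → wi≢0 (trans (sym (fold-invariant w inv i (toℕ j))) (trans (cong w e) wx))))) (sum-0 {k})))
       (ℤₚ.*-zeroʳ (w i)))
    sum-first : ∀ k → 1 ℕ.≤ k → (f : ℕ → ℤ) → (∀ j → 1 ℕ.≤ j → j ℕ.< k → f j ≡ + 0) →
      sumℤ {k} (λ j → f (toℕ j)) ≡ f 0
    sum-first (suc k) _ f z = trans (cong (_+_ (f 0)) (trans (sum-cong {k} (λ j → z (suc (toℕ j)) (s≤s z≤n) (s≤s (Finₚ.toℕ<n j)))) (sum-0 {k}))) (ℤₚ.+-identityʳ _)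
    -- Of the first `k` iterates only the one with index 0 is `i`, so `orbit i i` is 1 and `i`
    -- leaves the support.
    w′i : w′ i ≡ + 0
    w′i = trans (cong (λ z → w i - w i * z) (trans
            (sum-first k 1≤k (λ j → [ fold i σ j ≟ i ]) λ j 1≤j j<k →
              ⟦⟧-no (_ Fin.≟ _) (proj₂ (len i wi≢0) j 1≤j j<k)) (⟦⟧-yes (i Fin.≟ i) refl)))
            (trans (cong (λ z → w i - z) (ℤₚ.*-identityʳ (w i))) (ℤₚ.+-inverseʳ (w i)))
    len′ : OrbitsOfLength-k w′
    len′ x ne = len x (λ e → ne (w≡0⇒w′≡0 x e))
    sup′ : ∀ x → w′ x ≢ + 0 → x ∈ l
    sup′ x ne with sup x (λ e → ne (w≡0⇒w′≡0 x e))
    ... | here refl = ⊥-elim (ne w′i)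
    ... | there x∈l = x∈l

  orbit-length∣sum : (w : Fin m → ℤ) → (∀ x → w (σ x) ≡ w x) → OrbitsOfLength-k w → (+ k) ℤ∣.∣ sumℤ w
  orbit-length∣sum w inv len = peel (allFin m) w inv len (λ x _ → ∈-allFin x)

-- Powers in a finite abelian group, computed on indices.

module Group (F : FinAbGroup) where
  open FinAbGroup F renaming (refl to ≈-refl; sym to ≈-sym; trans to ≈-trans; _≟_ to _≈?_) hiding (_-_)
  open import Algebra.Properties.AbelianGroup abGroup using (∙-cancelˡ; identityˡ-unique; inverseˡ-unique; ⁻¹-∙-comm; ε⁻¹≈ε; ⁻¹-injective; ⁻¹-involutive)
  open import Algebra.Properties.CommutativeMonoid.Mult commutativeMonoid
    using () renaming (_×_ to _·_; ×-homo-+ to ·-homo-+; ×-assocˡ to ·-assocˡ; ×-congʳ to ·-congʳ; ×-distrib-+ to ·-distrib-∙)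
  open import Algebra.Properties.CommutativeMonoid.Sum commutativeMonoid
    using (sum; sum-permute; ∑-distrib-+; sum-replicate; sum-cong-≋)
  open import Relation.Binary.Reasoning.Setoid (AbelianGroup.setoid abGroup)

  v : ℕ
  v = size

  -- Passing to indices turns the setoid equality of the group into propositional equality on
  -- `Fin v`.
  index : Carrier → Fin v
  index g = proj₁ (enum-surj g)

  enum-index : ∀ g → enum (index g) ≈ g
  enum-index g = proj₂ (enum-surj g)

  index-cong : ∀ {g h} → g ≈ h → index g ≡ index h
  index-cong {g} {h} e = enum-inj _ _ (≈-trans (enum-index g) (≈-trans e (≈-sym (enum-index h))))

  index-injective : ∀ {g h} → index g ≡ index h → g ≈ h
  index-injective {g} {h} e = ≈-trans (≈-sym (enum-index g)) (≈-trans (reflexive (cong enum e)) (enum-index h))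

  index-enum : ∀ i → index (enum i) ≡ i
  index-enum i = enum-inj _ _ (enum-index (enum i))

  powℕ≡· : ∀ g k → powℕ F g k ≡ k · g
  powℕ≡· g zero    = refl
  powℕ≡· g (suc k) = cong (g ∙_) (powℕ≡· g k)

  -- Translation by `g` permutes the group, so the product of all elements equals itself times `g`
  -- to the power `v`, and it cancels.
  size·≈ε : ∀ g → v · g ≈ ε
  size·≈ε g = identityˡ-unique (v · g) (sum enum) (≈-sym (begin
    sum enum                              ≈⟨ sum-permute enum π ⟩
    sum (λ i → enum (π ⟨$⟩ʳ i))           ≈⟨ sum-cong-≋ (λ i → enum-index (g ∙ enum i)) ⟩
    sum (λ i → g ∙ enum i)                ≈⟨ ∑-distrib-+ (λ (_ : Fin v) → g) enum ⟩
    sum (λ (_ : Fin v) → g) ∙ sum enum    ≈⟨ ∙-congʳ (sum-replicate v) ⟩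
    (v · g) ∙ sum enum                    ∎))
    where
    shift : Carrier → Fin v → Fin v
    shift h i = index (h ∙ enum i)
    undo : ∀ h k → k ∙ h ≈ ε → ∀ i → shift k (shift h i) ≡ i
    undo h k e i = trans (index-cong (begin
      k ∙ enum (index (h ∙ enum i)) ≈⟨ ∙-congˡ (enum-index _) ⟩
      k ∙ (h ∙ enum i)              ≈⟨ assoc k h (enum i) ⟨
      (k ∙ h) ∙ enum i              ≈⟨ ∙-congʳ e ⟩
      ε ∙ enum i                    ≈⟨ identityˡ _ ⟩
      enum i                        ∎)) (index-enum i)
    π : Permutation′ v
    π = permutation (shift g) (shift (g ⁻¹)) (undo (g ⁻¹) g (inverseʳ g)) (undo g (g ⁻¹) (inverseˡ g))

  ·-mod : ∀ g a c → (a ℕ.+ c ℕ.* v) · g ≈ a · g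
  ·-mod g a c = begin
    (a ℕ.+ c ℕ.* v) · g     ≈⟨ ·-homo-+ g a (c ℕ.* v) ⟩
    a · g ∙ (c ℕ.* v) · g   ≈⟨ ∙-congˡ (·-assocˡ g c v) ⟨
    a · g ∙ c · (v · g)     ≈⟨ ∙-congˡ (≈-trans (·-congʳ c (size·≈ε g)) (·-ε c)) ⟩
    a · g ∙ ε               ≈⟨ identityʳ _ ⟩
    a · g                   ∎
    where
    ·-ε : ∀ c → c · ε ≈ ε
    ·-ε zero    = ≈-refl
    ·-ε (suc c) = ≈-trans (identityˡ _) (·-ε c)

  o : Fin v
  o = index ε

  pow : ℕ → Fin v → Fin v
  pow s i = index (s · enum i)

  enum-pow : ∀ s i → enum (pow s i) ≈ s · enum i
  enum-pow s i = enum-index _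

  pow-1 : ∀ i → pow 1 i ≡ i
  pow-1 i = trans (index-cong (identityʳ _)) (index-enum i)

  pow-∘ : ∀ a b i → pow a (pow b i) ≡ pow (a ℕ.* b) i
  pow-∘ a b i = index-cong (≈-trans (·-congʳ a (enum-pow b i)) (·-assocˡ (enum i) a b))

  -- Congruence of exponents modulo `v`, with natural multiples on both sides in place of a signed
  -- one.
  pow-cong-mod : ∀ {a b} c d → a ℕ.+ c ℕ.* v ≡ b ℕ.+ d ℕ.* v → ∀ i → pow a i ≡ pow b i
  pow-cong-mod {a} {b} c d e i = index-cong (begin
    a · enum i               ≈⟨ ·-mod (enum i) a c ⟨
    (a ℕ.+ c ℕ.* v) · enum i ≡⟨ cong (_· enum i) e ⟩
    (b ℕ.+ d ℕ.* v) · enum i ≈⟨ ·-mod (enum i) b d ⟩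
    b · enum i               ∎)

  pow-v : ∀ i → pow v i ≡ o
  pow-v i = index-cong (size·≈ε (enum i))

  pow-o : ∀ s → pow s o ≡ o
  pow-o s = trans (cong (pow s) (sym (pow-v o))) (trans (pow-∘ s v o)
              (pow-cong-mod {s ℕ.* v} {0} 0 s (ℕₚ.+-identityʳ _) o))

  _⊗_ : Fin v → Fin v → Fin v
  i ⊗ j = index (enum i ∙ enum j)

  ⊗-comm : ∀ i j → i ⊗ j ≡ j ⊗ i
  ⊗-comm i j = index-cong (comm _ _)

  ⊗-double : ∀ i → i ⊗ i ≡ pow 2 i
  ⊗-double i = index-cong (∙-congˡ (≈-sym (identityʳ _)))

  inv : Fin v → Fin v
  inv i = index (enum i ⁻¹)

  _⊘_ : Fin v → Fin v → Fin v
  i ⊘ j = i ⊗ inv j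

  inv-injective : ∀ {i j} → inv i ≡ inv j → i ≡ j
  inv-injective {i} {j} e = enum-inj i j (⁻¹-injective (index-injective e))

  ·-⁻¹ : ∀ s g → s · (g ⁻¹) ≈ (s · g) ⁻¹
  ·-⁻¹ zero    g = ≈-sym ε⁻¹≈ε
  ·-⁻¹ (suc s) g = ≈-trans (∙-congˡ (·-⁻¹ s g)) (⁻¹-∙-comm g (s · g))

  inv-pow : ∀ s i → inv (pow s i) ≡ pow s (inv i)
  inv-pow s i = index-cong (begin
    enum (pow s i) ⁻¹     ≈⟨ ⁻¹-cong (enum-pow s i) ⟩
    (s · enum i) ⁻¹       ≈⟨ ·-⁻¹ s (enum i) ⟨
    s · (enum i ⁻¹)       ≈⟨ ·-congʳ s (enum-index _) ⟨
    s · enum (inv i)      ∎)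

  pow-⊘ : ∀ s i j → pow s i ⊘ pow s j ≡ pow s (i ⊘ j)
  pow-⊘ s i j = index-cong (begin
    enum (pow s i) ∙ enum (inv (pow s j)) ≈⟨ ∙-congʳ (enum-pow s i) ⟩
    s · enum i ∙ enum (inv (pow s j))     ≡⟨ cong (λ z → s · enum i ∙ enum z) (inv-pow s j) ⟩
    s · enum i ∙ enum (pow s (inv j))     ≈⟨ ∙-congˡ (enum-pow s (inv j)) ⟩
    s · enum i ∙ s · enum (inv j)         ≈⟨ ·-distrib-∙ _ _ s ⟨
    s · (enum i ∙ enum (inv j))           ≈⟨ ·-congʳ s (enum-index _) ⟨
    s · enum (i ⊘ j)                      ∎)

  ⊘≡o⇒≡ : ∀ i j → i ⊘ j ≡ o → i ≡ j
  ⊘≡o⇒≡ i j e = enum-inj i j (≈-trans (inverseˡ-unique _ _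
      (≈-trans (∙-congˡ (≈-sym (enum-index _))) (index-injective e))) (⁻¹-involutive (enum j)))

  ⊘-self : ∀ i → i ⊘ i ≡ o
  ⊘-self i = index-cong (≈-trans (∙-congˡ (enum-index _)) (inverseʳ _))

  pow-inv : ∀ a b c → a ℕ.+ b ≡ c ℕ.* v → ∀ i → pow a i ≡ inv (pow b i)
  pow-inv a b c e i = index-cong (≈-trans (inverseˡ-unique _ _ (begin
    a · enum i ∙ b · enum i   ≈⟨ ·-homo-+ (enum i) a b ⟨
    (a ℕ.+ b) · enum i        ≡⟨ cong (_· enum i) e ⟩
    (c ℕ.* v) · enum i        ≈⟨ ·-mod (enum i) 0 c ⟩
    ε                         ∎)) (⁻¹-cong (≈-sym (enum-pow b i))))

  -- Bézout yields `x` with x s congruent to 1 or to -1 modulo `v`. In the first case `pow x` undoes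
  -- `pow s`; in the second it does so up to inversion, which is injective.
  pow-injective : ∀ {s} → Coprime s v → ∀ {i j} → pow s i ≡ pow s j → i ≡ j
  pow-injective {s} cop {i} {j} e with Coprimality.coprime-Bézout cop
  ... | Bézout.+- x y eq = trans (sym (back i)) (trans (cong (pow x) e) (back j))
    where
    back : ∀ i → pow x (pow s i) ≡ i
    back i = trans (pow-∘ x s i) (trans (pow-cong-mod {x ℕ.* s} {1} 0 y (trans (ℕₚ.+-identityʳ _) (sym eq)) i) (pow-1 i))
  ... | Bézout.-+ x y eq = inv-injective (trans (sym (back i)) (trans (cong (pow x) e) (back j)))
    where
    back : ∀ i → pow x (pow s i) ≡ inv i
    back i = trans (pow-∘ x s i) (trans (pow-inv (x ℕ.* s) 1 y (trans (ℕₚ.+-comm _ 1) eq) i)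
               (cong inv (pow-1 i)))

  fold-pow : ∀ t i j → fold i (pow t) j ≡ pow (t ℕ.^ j) i
  fold-pow t i zero    = sym (pow-1 i)
  fold-pow t i (suc j) = trans (cong (pow t) (fold-pow t i j)) (pow-∘ t (t ℕ.^ j) i)

  pow-kernel : ∀ {a} → ∀ i → pow a i ≡ o → ∀ c r → pow (r ℕ.+ c ℕ.* a) i ≡ pow r i
  pow-kernel {a} i ea c r = index-cong (begin
    (r ℕ.+ c ℕ.* a) · enum i       ≈⟨ ·-homo-+ (enum i) r (c ℕ.* a) ⟩
    r · enum i ∙ (c ℕ.* a) · enum i ≈⟨ ∙-congˡ (index-injective (trans (sym (pow-∘ c a i)) (trans (cong (pow c) ea) (pow-o c)))) ⟩
    r · enum i ∙ ε                 ≈⟨ identityʳ _ ⟩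
    r · enum i                     ∎)

  coprime-exponents⇒trivial : ∀ {a b} → Coprime a b → ∀ i → pow a i ≡ o → pow b i ≡ o → i ≡ o
  coprime-exponents⇒trivial {a} {b} cop i ea eb with Coprimality.coprime-Bézout cop
  ... | Bézout.+- x y eq = trans (sym (pow-1 i)) (trans (sym (pow-kernel {b} i eb y 1))
          (trans (cong (λ z → pow z i) eq) (pow-kernel {a} i ea x 0)))
  ... | Bézout.-+ x y eq = trans (sym (pow-1 i)) (trans (sym (pow-kernel {a} i ea x 1))
          (trans (cong (λ z → pow z i) eq) (pow-kernel {b} i eb y 0)))

  pow≡id⇒kernel : ∀ s i → pow (suc s) i ≡ i → pow s i ≡ o
  pow≡id⇒kernel s i e = index-cong (∙-cancelˡ (enum i) _ _ (≈-trans (≈-trans (≈-sym (enum-pow (suc s) i)) (reflexive (cong enum e))) (≈-sym (identityʳ _))))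

-- Squares, parity and halving of integers.

square≡+ : ∀ i → i * i ≡ + (∣ i ∣ ℕ.* ∣ i ∣)
square≡+ (+ a)    = sym (ℤₚ.pos-* a a)
square≡+ -[1+ a ] = refl

square≥0 : ∀ i → + 0 ℤ.≤ i * i
square≥0 i = subst (+ 0 ℤ.≤_) (sym (square≡+ i)) (ℤ.+≤+ z≤n)

square-cancel-≤ : ∀ {a b} → a ℕ.* a ℕ.≤ b ℕ.* b → a ℕ.≤ b
square-cancel-≤ {a} {b} p with a ℕ.≤? b
... | yes q = q
... | no  q = ⊥-elim (ℕₚ.<⇒≱ (ℕₚ.*-mono-< (ℕₚ.≰⇒> q) (ℕₚ.≰⇒> q)) p)

2∣square⇒2∣ : ∀ y → (+ 2) ℤ∣.∣ y * y → (+ 2) ℤ∣.∣ y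
2∣square⇒2∣ y d = ℤ∣.∣ᵤ⇒∣ ([ id , id ]′ (euclidsLemma ∣ y ∣ ∣ y ∣ (toWitness {a? = prime? 2} _)
  (subst (2 ℕ∣.∣_) (ℤₚ.abs-* y y) (ℤ∣.∣⇒∣ᵤ d))))

-- Floor division, exact on even integers only. Being a function of the value, it preserves
-- invariance along orbits.
half : ℤ → ℤ
half y = y ℤ./ℕ 2

half-even : ∀ y → (+ 2) ℤ∣.∣ y → y ≡ half y * + 2
half-even y (divides c e) = trans (ℤDM.a≡a%ℕn+[a/ℕn]*n y 2) (trans (cong (λ z → + z + half y * + 2) r≡0) (ℤₚ.+-identityˡ _))
  where
  r = y ℤ.%ℕ 2
  lem : ∀ r d c → r + d * + 2 ≡ c * + 2 → r ≡ (c - d) * + 2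
  lem r d c e = trans (l₁ r d) (trans (cong (λ z → z - d * + 2) e) (l₂ c d))
    where
    l₁ : ∀ r d → r ≡ r + d * + 2 - d * + 2
    l₁ = solve-∀
    l₂ : ∀ c d → c * + 2 - d * + 2 ≡ (c - d) * + 2
    l₂ = solve-∀
  2∣r : 2 ℕ∣.∣ r
  2∣r = ℤ∣.∣⇒∣ᵤ {+ 2} {+ r} (divides (c - half y) (lem (+ r) (half y) c (trans (sym (ℤDM.a≡a%ℕn+[a/ℕn]*n y 2)) e)))
  r≡0 : r ≡ 0
  r≡0 with r in eq | 2∣r | ℤDM.n%ℕd<d y 2
  ... | zero  | _ | _ = refl
  ... | suc r | d | l = ⊥-elim (ℕ∣.>⇒∤ l d)

-- For t ≥ 1 no subtraction truncates, and k is the multiplicative order of t modulo q.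
record PrimeOrder (t q k : ℕ) : Set where
  field
    prime   : Prime q
    1≤k     : 1 ℕ.≤ k
    period  : q ℕ∣.∣ t ℕ.^ k ℕ.∸ 1
    minimal : ∀ j → 1 ℕ.≤ j → j ℕ.< k → ¬ q ℕ∣.∣ t ℕ.^ j ℕ.∸ 1

-- Push-forward of coefficient functions; along `pow s` it is the map Y to Y^(s).

push : ∀ {m} → (Fin m → Fin m) → (Fin m → ℤ) → Fin m → ℤ
push φ Y i = sumℤ (λ j → Y j * [ φ j ≟ i ])

-- Change of variables, after exchanging the two sums. It lets a map on coefficients be moved onto
-- the group elements.
push-adjoint : ∀ {m} (φ : Fin m → Fin m) (Y w : Fin m → ℤ) →
  sumℤ (λ i → push φ Y i * w i) ≡ sumℤ (λ j → Y j * w (φ j))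
push-adjoint φ Y w = begin
  sumℤ (λ i → push φ Y i * w i)                     ≡⟨ sum-cong (λ i → sym (sum-*ʳ (w i) (λ j → Y j * [ φ j ≟ i ]))) ⟩
  sumℤ (λ i → sumℤ (λ j → Y j * [ φ j ≟ i ] * w i)) ≡⟨ sum-swap (λ i j → Y j * [ φ j ≟ i ] * w i) ⟩
  sumℤ (λ j → sumℤ (λ i → Y j * [ φ j ≟ i ] * w i)) ≡⟨ sum-cong (λ j → trans (sum-cong (λ i → lem (Y j) _ (w i))) (sum-*ˡ (Y j) (λ i → w i * [ φ j ≟ i ]))) ⟩
  sumℤ (λ j → Y j * sumℤ (λ i → w i * [ φ j ≟ i ])) ≡⟨ sum-cong (λ j → cong (Y j *_) (sum-pick w (φ j))) ⟩
  sumℤ (λ j → Y j * w (φ j))                        ∎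
  where
  open ≡-Reasoning
  lem : ∀ a b c → a * b * c ≡ a * (c * b)
  lem = solve-∀

push-∘ : ∀ {m} (ψ φ : Fin m → Fin m) Y → push ψ (push φ Y) ≗ push (ψ ∘ φ) Y
push-∘ ψ φ Y i = push-adjoint φ Y (λ l → [ ψ l ≟ i ])

push-congʳ : ∀ {m} (φ : Fin m → Fin m) {Y Z} → Y ≗ Z → push φ Y ≗ push φ Z
push-congʳ φ e i = sum-cong (λ j → cong (_* [ φ j ≟ i ]) (e j))

push-congˡ : ∀ {m} {φ ψ : Fin m → Fin m} Y → φ ≗ ψ → push φ Y ≗ push ψ Y
push-congˡ Y e i = sum-cong (λ j → cong (λ z → Y j * [ z ≟ i ]) (e j))

push-id : ∀ {m} {φ : Fin m → Fin m} → (∀ i → φ i ≡ i) → ∀ Y → push φ Y ≗ Y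
push-id e Y i = trans (push-congˡ Y e i) (trans (sum-cong (λ j → cong (Y j *_) ([≟]-sym j i))) (sum-pick Y i))

sum-push : ∀ {m} (φ : Fin m → Fin m) Y → sumℤ (push φ Y) ≡ sumℤ Y
sum-push φ Y = trans (sum-cong (λ i → sym (ℤₚ.*-identityʳ (push φ Y i))))
  (trans (push-adjoint φ Y (λ _ → + 1)) (sum-cong (λ j → ℤₚ.*-identityʳ (Y j))))

push-injective : ∀ {m} (φ : Fin m → Fin m) → (∀ {i j} → φ i ≡ φ j → i ≡ j) → ∀ Y i → push φ Y (φ i) ≡ Y i
push-injective φ inj Y i = trans (sum-cong (λ j → cong (Y j *_)
    (⟦⟧-cong (sym ∘ inj) (cong φ ∘ sym) (φ j Fin.≟ φ i) (i Fin.≟ j)))) (sum-pick Y i)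

-- The quadratic form with matrix `f`, nested so that `push-adjoint` applies to each variable in
-- turn.
double : ∀ {m} → (Fin m → ℤ) → (Fin m → Fin m → ℤ) → ℤ
double Y f = sumℤ (λ j → Y j * sumℤ (λ k → Y k * f j k))

double-cong : ∀ {m} (Y : Fin m → ℤ) {f g : Fin m → Fin m → ℤ} → (∀ j k → f j k ≡ g j k) → double Y f ≡ double Y g
double-cong Y e = sum-cong (λ j → cong (Y j *_) (sum-cong (λ k → cong (Y k *_) (e j k))))

double-push : ∀ {m} (φ : Fin m → Fin m) Y f → double (push φ Y) f ≡ double Y (λ j k → f (φ j) (φ k))
double-push φ Y f = trans (push-adjoint φ Y _) (sum-cong (λ j → cong (Y j *_) (push-adjoint φ Y (f (φ j)))))

double-*ʳ : ∀ {m} (Y : Fin m → ℤ) f c → double Y f * c ≡ double Y (λ j k → f j k * c)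
double-*ʳ Y f c = trans (sym (sum-*ʳ c (λ j → Y j * S j))) (sum-cong (λ j → trans (ℤₚ.*-assoc (Y j) (S j) c)
  (cong (Y j *_) (trans (sym (sum-*ʳ c (λ k → Y k * f j k))) (sum-cong (λ k → ℤₚ.*-assoc (Y k) (f j k) c))))))
  where
  S : _ → ℤ
  S j = sumℤ (λ k → Y k * f j k)

sum-double : ∀ {m} (Y : Fin m → ℤ) (f : Fin m → Fin m → Fin m → ℤ) →
  sumℤ (λ i → double Y (f i)) ≡ double Y (λ j k → sumℤ (λ i → f i j k))
sum-double Y f = trans (sum-swap (λ i j → Y j * sumℤ (λ k → Y k * f i j k))) (sum-cong (λ j →
  trans (sum-*ˡ (Y j) (λ i → sumℤ (λ k → Y k * f i j k))) (cong (Y j *_) (trans (sum-swap (λ i k → Y k * f i j k)) (sum-cong (λ k → sum-*ˡ (Y k) (λ i → f i j k)))))))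

-- Coefficients of the group ring elements that satisfy the three identities.

module Multiplier (F : FinAbGroup) (t n : ℕ) (t-coprime : Coprime t (FinAbGroup.size F)) (1≤t : 1 ℕ.≤ t) (1≤n : 1 ℕ.≤ n) where
  open Group F

  -- The coefficient of `i` in Y Y^(-1), with the inversion moved onto the group elements.
  conv : (Fin v → ℤ) → Fin v → ℤ
  conv Y i = double Y (λ j k → [ j ⊘ k ≟ i ])

  -- `pow s` is an endomorphism, so its linear extension respects products and inversion. The chain
  -- inserts a sum over the quotient `l` of `j` and `k`.
  conv-push : ∀ s Y → conv (push (pow s) Y) ≗ push (pow s) (conv Y)
  conv-push s Y i = begin
    double (push (pow s) Y) (λ j k → [ j ⊘ k ≟ i ])  ≡⟨ double-push (pow s) Y _ ⟩
    double Y (λ j k → [ pow s j ⊘ pow s k ≟ i ])     ≡⟨ double-cong Y (λ j k →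
       trans (cong [_≟ i ] (pow-⊘ s j k)) (sym (sum-pick (λ l → [ pow s l ≟ i ]) (j ⊘ k)))) ⟩
    double Y (λ j k → sumℤ (λ l → [ pow s l ≟ i ] * [ j ⊘ k ≟ l ])) ≡⟨ double-cong Y (λ j k → sum-cong (λ l → ℤₚ.*-comm [ pow s l ≟ i ] _)) ⟩
    double Y (λ j k → sumℤ (λ l → [ j ⊘ k ≟ l ] * [ pow s l ≟ i ])) ≡⟨ sum-double Y (λ l j k → [ j ⊘ k ≟ l ] * [ pow s l ≟ i ]) ⟨
    sumℤ (λ l → double Y (λ j k → [ j ⊘ k ≟ l ] * [ pow s l ≟ i ])) ≡⟨ sum-cong (λ l → double-*ʳ Y (λ j k → [ j ⊘ k ≟ l ]) [ pow s l ≟ i ]) ⟨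
    push (pow s) (conv Y) i ∎
    where open ≡-Reasoning

  record Good (Y : Fin v → ℤ) : Set where
    field
      multiplier : push (pow t) Y ≗ Y
      augment    : sumℤ Y ≡ + n
      norm       : ∀ i → conv Y i ≡ + (n ℕ.* n) * [ o ≟ i ]

    pointwise : ∀ i → Y (pow t i) ≡ Y i
    pointwise i = trans (sym (multiplier _)) (push-injective (pow t) (pow-injective t-coprime) Y i)

    -- This is the coefficient of the identity in Y Y^(-1): the quotient of `j` and `k` is trivial
    -- only when they are equal.
    sum-squares : sumℤ (λ j → Y j * Y j) ≡ + (n ℕ.* n)
    sum-squares = trans (sum-cong (λ j → cong (Y j *_) (sym (trans
      (sum-cong (λ k → cong (Y k *_) (⟦⟧-cong (⊘≡o⇒≡ j k) (λ e → trans (cong (j ⊘_) (sym e)) (⊘-self j)) (_ Fin.≟ o) (j Fin.≟ k))))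
      (sum-pick Y j))))) (trans (norm o) (trans (cong (+ (n ℕ.* n) *_) (⟦⟧-yes (o Fin.≟ o) refl)) (ℤₚ.*-identityʳ _)))

    -- The square of `Y o` then already exhausts the sum of squares.
    extremal : ∣ Y o ∣ ≡ n → Y ≗ (λ i → Y o * [ o ≟ i ])
    extremal e i with o Fin.≟ i
    ... | yes refl = sym (ℤₚ.*-identityʳ _)
    ... | no o≢i = trans ([ id , id ]′ (ℤₚ.i*j≡0⇒i≡0∨j≡0 (Y i)
        (others-vanish (λ j → Y j * Y j) (λ j → square≥0 (Y j)) o
          (trans sum-squares (sym (trans (square≡+ (Y o)) (cong (λ z → + (z ℕ.* z)) e)))) i o≢i)))
        (sym (ℤₚ.*-zeroʳ (Y o)))

    -- Off the identity everything vanishes, so `Y o` is the coefficient sum, which settles its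
    -- sign.
    extremal⇒n : ∣ Y o ∣ ≡ n → Y o ≡ + n
    extremal⇒n e = trans (sym (trans (sum-cong (extremal e)) (sum-pick (λ _ → Y o) o))) augment

    ∣Yo∣≤n : ∣ Y o ∣ ℕ.≤ n
    ∣Yo∣≤n = square-cancel-≤ (ℤₚ.drop‿+≤+ (subst₂ ℤ._≤_ (square≡+ (Y o)) sum-squares
               (term≤sum (λ j → Y j * Y j) (λ j → square≥0 (Y j)) o)))

    -- `∣Yo∣≤n` gives 0 ≤ e ≤ 2n. The value 2n would mean that `Y o` is -n, against `extremal⇒n`;
    -- the strict bound is what the descent needs.
    deficiency : ∃ λ e → Y o + + e ≡ + n × e ℕ.< n ℕ.+ n
    deficiency with Y o in eq | ∣Yo∣≤n | extremal⇒n
    ... | + a      | a≤n | _ = n ℕ.∸ a , cong +_ (ℕₚ.m+[n∸m]≡n a≤n) ,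
            ℕₚ.≤-<-trans (ℕₚ.m∸n≤m n a) (ℕₚ.m<m+n n 1≤n)
    ... | -[1+ a ] | a<n | ext with ℕₚ.m≤n⇒m<n∨m≡n a<n
    ...   | inj₁ a<n = n ℕ.+ suc a , lem (+ n) (+ (suc a)) , ℕₚ.+-monoʳ-< n a<n
      where
      lem : ∀ n a → - a + (n + a) ≡ n
      lem = solve-∀
    ...   | inj₂ refl with () ← ext refl

  -- `pow s` is an endomorphism that commutes with `pow t` and fixes the identity, so Y^(s) inherits
  -- all three identities.
  push-good : ∀ s {Y} → Good Y → Good (push (pow s) Y)
  push-good s {Y} g = record
    { multiplier = λ i → trans (push-∘ (pow t) (pow s) Y i) (trans
        (push-congˡ Y (λ j → trans (pow-∘ t s j) (trans (cong (λ z → pow z j) (ℕₚ.*-comm t s)) (sym (pow-∘ s t j)))) i)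
        (trans (sym (push-∘ (pow s) (pow t) Y i)) (push-congʳ (pow s) multiplier i)))
    ; augment = trans (sum-push (pow s) Y) augment
    ; norm = λ i → trans (conv-push s Y i) (trans (sum-cong (λ j → trans (cong (_* [ pow s j ≟ i ]) (norm j)) (lem (+ (n ℕ.* n)) [ o ≟ j ] [ pow s j ≟ i ])))
        (trans (sum-pick (λ j → + (n ℕ.* n) * [ pow s j ≟ i ]) o) (cong (λ z → + (n ℕ.* n) * [ z ≟ i ]) (pow-o s))))
    }
    where
    open Good g
    lem : ∀ a b c → a * b * c ≡ a * c * b
    lem = solve-∀

  multiplier-^ : ∀ {Y} → Good Y → ∀ N → push (pow (t ℕ.^ N)) Y ≗ Y
  multiplier-^ {Y} g zero    = push-id pow-1 Y
  multiplier-^ {Y} g (suc N) i = trans (sym (trans (push-∘ (pow t) (pow (t ℕ.^ N)) Y i) (push-congˡ Y (pow-∘ t (t ℕ.^ N)) i)))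
    (trans (push-congʳ (pow t) (multiplier-^ g N) i) (Good.multiplier g i))

  t^ : ∀ j → t ℕ.^ j ≡ suc (t ℕ.^ j ℕ.∸ 1)
  t^ j = sym (ℕₚ.m+[n∸m]≡n (ℕₚ.m^n>0 t {{ℕ.>-nonZero 1≤t}} j))

  -- For prime `q`, the indicator of the elements of order `q`.
  exponent-q : ℕ → Fin v → ℤ
  exponent-q q j = ⟦ ¬? (j Fin.≟ o) ×-dec (pow q j Fin.≟ o) ⟧

  module _ {q k} (po : PrimeOrder t q k) where
    open PrimeOrder po

    -- If t^j fixes `x` of order `q`, then t^j - 1 kills `x`. Were this exponent coprime to `q`,
    -- then `x` would be trivial; so `q` divides it, and every orbit of `pow t` on these elements
    -- has length `k`.
    k∣exponent-q-sum : (Z : Fin v → ℤ) → (∀ i → Z (pow t i) ≡ Z i) → (+ k) ℤ∣.∣ sumℤ (λ j → Z j * exponent-q q j)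
    k∣exponent-q-sum Z inv-Z = orbit-length∣sum (λ j → Z j * exponent-q q j) inv-w len
      where
      open Orbits (pow t) (pow-injective t-coprime) 1≤k
      inv-w : ∀ x → Z (pow t x) * exponent-q q (pow t x) ≡ Z x * exponent-q q x
      inv-w x = cong₂ _*_ (inv-Z x) (⟦⟧-cong
        (λ (a , b) → (λ e → a (trans (cong (pow t) e) (pow-o t))) ,
                     pow-injective t-coprime (trans (pow-comm x) (trans b (sym (pow-o t)))))
        (λ (a , b) → (λ e → a (pow-injective t-coprime (trans e (sym (pow-o t))))) ,
                     trans (sym (pow-comm x)) (trans (cong (pow t) b) (pow-o t))) _ _)
        where
        pow-comm : ∀ x → pow t (pow q x) ≡ pow q (pow t x)
        pow-comm x = trans (pow-∘ t q x) (trans (cong (λ z → pow z x) (ℕₚ.*-comm t q)) (sym (pow-∘ q t x)))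
      len : OrbitsOfLength-k (λ j → Z j * exponent-q q j)
      len x ne with ¬? (x Fin.≟ o) ×-dec (pow q x Fin.≟ o)
      ... | no _ = ⊥-elim (ne (ℤₚ.*-zeroʳ (Z x)))
      ... | yes (x≢o , qx) = cyc period , free
        where
        cyc : q ℕ∣.∣ t ℕ.^ k ℕ.∸ 1 → fold x (pow t) k ≡ x
        cyc (ℕ∣.divides c e) = trans (fold-pow t x k) (trans (cong (λ z → pow z x) (trans (t^ k) (cong suc e)))
          (trans (pow-kernel x qx c 1) (pow-1 x)))
        free : ∀ j → 1 ℕ.≤ j → j ℕ.< k → fold x (pow t) j ≢ x
        free j 1≤j j<k e = x≢o (coprime-exponents⇒trivial cop x qx
          (pow≡id⇒kernel (t ℕ.^ j ℕ.∸ 1) x (trans (cong (λ z → pow z x) (sym (t^ j))) (trans (sym (fold-pow t x j)) e))))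
          where
          cop : Coprime q (t ℕ.^ j ℕ.∸ 1)
          cop (d∣q , d∣r) with prime⇒irreducible prime d∣q
          ... | inj₁ d≡1  = d≡1
          ... | inj₂ refl = ⊥-elim (minimal j 1≤j j<k d∣r)

    -- Raising to the power `q` sends to the identity exactly the identity and the elements of order
    -- `q`.
    push-at-o : ∀ Y → push (pow q) Y o ≡ Y o + sumℤ (λ j → Y j * exponent-q q j)
    push-at-o Y = trans (sum-cong (λ j → trans (cong (Y j *_) (split j)) (ℤₚ.*-distribˡ-+ (Y j) [ o ≟ j ] (exponent-q q j))))
      (trans (sum-+ (λ j → Y j * [ o ≟ j ]) (λ j → Y j * exponent-q q j)) (cong (_+ sumℤ (λ j → Y j * exponent-q q j)) (sum-pick Y o)))
      where
      split : ∀ j → [ pow q j ≟ o ] ≡ [ o ≟ j ] + exponent-q q j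
      split j with j Fin.≟ o
      ... | yes refl rewrite ⟦⟧-yes (o Fin.≟ o) refl = ⟦⟧-yes (_ Fin.≟ o) (pow-o q)
      ... | no j≢o rewrite ⟦⟧-no (o Fin.≟ j) (j≢o ∘ sym) =
              trans (⟦⟧-cong (j≢o ,_) proj₂ _ (yes j≢o ×-dec (pow q j Fin.≟ o))) (sym (ℤₚ.+-identityˡ _))

    step : ∀ {Y} → Good Y → ∃ λ c → push (pow q) Y o ≡ Y o + c * + k
    step {Y} g with k∣exponent-q-sum Y (Good.pointwise g)
    ... | divides c e = c , trans (push-at-o Y) (cong (_+_ (Y o)) e)

    -- The orbit count is applied to the halved coefficients, which are again constant along orbits;
    -- doubling back gives a multiple of 2k.
    step-even : ∀ {Y} → Good Y → (∀ j → j ≢ o → (+ 2) ℤ∣.∣ Y j) → ∃ λ c → push (pow q) Y o ≡ Y o + c * + (k ℕ.+ k)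
    step-even {Y} g even with k∣exponent-q-sum (half ∘ Y) (λ i → cong half (Good.pointwise g i))
    ... | divides c e = c , trans (push-at-o Y) (cong (_+_ (Y o)) (begin
      sumℤ (λ j → Y j * exponent-q q j)              ≡⟨ sum-cong halve ⟩
      sumℤ (λ j → half (Y j) * exponent-q q j * + 2) ≡⟨ sum-*ʳ (+ 2) (λ j → half (Y j) * exponent-q q j) ⟩
      sumℤ (λ j → half (Y j) * exponent-q q j) * + 2 ≡⟨ cong (_* + 2) e ⟩
      c * + k * + 2                                ≡⟨ lem c (+ k) ⟩
      c * (+ k + + k)                              ∎))
      where
      open ≡-Reasoning
      lem : ∀ c k → c * k * + 2 ≡ c * (k + k)
      lem = solve-∀
      halve : ∀ j → Y j * exponent-q q j ≡ half (Y j) * exponent-q q j * + 2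
      halve j with j Fin.≟ o
      -- At the identity the indicator is 0, so both sides vanish.
      ... | yes _ = trans (ℤₚ.*-zeroʳ (Y j)) (cong (_* + 2) (sym (ℤₚ.*-zeroʳ (half (Y j)))))
      ... | no j≢o = trans (cong (_* x) (half-even (Y j) (even j j≢o))) (lem₂ (half (Y j)) x)
        where
        x = ⟦ yes j≢o ×-dec (pow q j Fin.≟ o) ⟧
        lem₂ : ∀ h x → h * + 2 * x ≡ h * x * + 2
        lem₂ = solve-∀

  -- If Y⁽⁻¹⁾ = Y then n² = Y² ≡ Y⁽²⁾ modulo 2, and squaring is injective on a group of odd order.
  real⇒even : Coprime 2 v → ∀ {Y} → Good Y → push inv Y ≗ Y → ∀ j → j ≢ o → (+ 2) ℤ∣.∣ Y j
  real⇒even odd {Y} g real l l≢o = 2∣square⇒2∣ (Y l) (divides (- c) (lem _ c (begin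
    Y l * Y l + c * + 2                                   ≡⟨ cong (_+ c * + 2) diagonal ⟨
    sumℤ (λ j → a j j) + c * + 2                          ≡⟨ proj₂ parity ⟨
    sumℤ (λ j → sumℤ (a j))                               ≡⟨ sum-cong (λ j → sum-*ˡ (Y j) (λ k → Y k * [ j ⊗ k ≟ i ])) ⟩
    -- `real` replaces the second factor by Y^(-1), and adjointness turns the product of `j` and `k`
    -- into their quotient.
    double Y (λ j k → [ j ⊗ k ≟ i ])                      ≡⟨ sum-cong (λ j → cong (Y j *_) (trans
        (sum-cong (λ k → cong (_* [ j ⊗ k ≟ i ]) (sym (real k)))) (push-adjoint inv Y (λ k → [ j ⊗ k ≟ i ])))) ⟩
    conv Y i                                              ≡⟨ Good.norm g i ⟩
    + (n ℕ.* n) * [ o ≟ i ]                               ≡⟨ cong (+ (n ℕ.* n) *_) (⟦⟧-no (o Fin.≟ i)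
        (λ e → l≢o (pow-injective odd (trans (sym e) (sym (pow-o 2)))))) ⟩
    + (n ℕ.* n) * + 0                                     ≡⟨ ℤₚ.*-zeroʳ (+ (n ℕ.* n)) ⟩
    + 0                                                   ∎)))
    where
    open ≡-Reasoning
    i = pow 2 l
    a : Fin v → Fin v → ℤ
    a j k = Y j * (Y k * [ j ⊗ k ≟ i ])
    swap₂ : ∀ x y z → x * (y * z) ≡ y * (x * z)
    swap₂ = solve-∀
    parity = symmetric-sum-parity a (λ j k → trans (swap₂ (Y j) (Y k) _) (cong (λ z → Y k * (Y j * [ z ≟ i ])) (⊗-comm j k)))
    c = proj₁ parity
    -- The squares of `j` and `l` agree only if `j` is `l`, because squaring is injective in odd
    -- order.
    diagonal : sumℤ (λ j → a j j) ≡ Y l * Y l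
    diagonal = trans (sum-cong (λ j → trans (sym (ℤₚ.*-assoc (Y j) (Y j) _)) (cong (Y j * Y j *_)
      (⟦⟧-cong (λ e → sym (pow-injective odd (trans (sym (⊗-double j)) e))) (λ e → trans (⊗-double j) (cong (pow 2) (sym e)))
         (j ⊗ j Fin.≟ i) (l Fin.≟ j))))) (sum-pick (λ j → Y j * Y j) l)
    lem : ∀ x c → x + c * + 2 ≡ + 0 → x ≡ - c * + 2
    lem x c e = trans (l₁ x c) (trans (cong (_+ - c * + 2) e) (ℤₚ.+-identityˡ _))
      where
      l₁ : ∀ x c → x ≡ x + c * + 2 + - c * + 2
      l₁ = solve-∀

-- Congruences for powers of numbers near 1 and -1.

^-first-order : ∀ c j → ∃ λ T → c ℤ.^ j ≡ + 1 + (c - + 1) * + j + (c - + 1) * (c - + 1) * T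
^-first-order c zero    = + 0 , lem c
  where
  lem : ∀ c → + 1 ≡ + 1 + (c - + 1) * + 0 + (c - + 1) * (c - + 1) * + 0
  lem = solve-∀
^-first-order c (suc j) with ^-first-order c j
... | T , e = T + + j + (c - + 1) * T , trans (cong (c *_) e) (lem c (+ j) T)
  where
  lem : ∀ c j T → c * (+ 1 + (c - + 1) * j + (c - + 1) * (c - + 1) * T) ≡
        + 1 + (c - + 1) * (+ 1 + j) + (c - + 1) * (c - + 1) * (T + j + (c - + 1) * T)
  lem = solve-∀

∣-1⇒∣^-1 : ∀ {d a} j → d ℤ∣.∣ a - + 1 → d ℤ∣.∣ a ℤ.^ j - + 1
∣-1⇒∣^-1 {d} {a} j d∣ with ^-first-order a j
... | T , e = subst (d ℤ∣.∣_) (sym (trans (cong (_- + 1) e) (lem (a - + 1) (+ j) T)))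
                (ℤ∣.∣m⇒∣m*n (+ j + (a - + 1) * T) d∣)
  where
  lem : ∀ x j T → + 1 + x * j + x * x * T - + 1 ≡ x * (j + x * T)
  lem = solve-∀

-- Lifting the exponent: with x = c - 1, c^q - 1 = x q + x x T. Since `P` and `q` both divide x,
-- their product divides each term.
∣-1⇒*∣^-1 : ∀ {P c} q → + P ℤ∣.∣ c - + 1 → + q ℤ∣.∣ c - + 1 → + (q ℕ.* P) ℤ∣.∣ c ℤ.^ q - + 1
∣-1⇒*∣^-1 {P} {c} q (divides u eu) (divides w ew) with ^-first-order c q
... | T , e = divides (u + u * w * T) (begin
  c ℤ.^ q - + 1                                  ≡⟨ cong (_- + 1) e ⟩
  + 1 + x * + q + x * x * T - + 1                ≡⟨ lem₁ x (+ q) T ⟩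
  x * + q + x * x * T                            ≡⟨ cong₂ (λ a b → a * + q + a * b * T) eu ew ⟩
  u * + P * + q + u * + P * (w * + q) * T        ≡⟨ lem₂ u (+ P) (+ q) w T ⟩
  (u + u * w * T) * (+ q * + P)                  ≡⟨ cong ((u + u * w * T) *_) (ℤₚ.pos-* q P) ⟨
  (u + u * w * T) * + (q ℕ.* P)                  ∎)
  where
  open ≡-Reasoning
  x = c - + 1
  lem₁ : ∀ x j T → + 1 + x * j + x * x * T - + 1 ≡ x * j + x * x * T
  lem₁ = solve-∀
  lem₂ : ∀ u P q w T → u * P * q + u * P * (w * q) * T ≡ (u + u * w * T) * (q * P)
  lem₂ = solve-∀

-- Induction over the factors, repeated ones included: a^P is 1 modulo `P` by induction and 1 modulo
-- `q` because `a` is; raising to the power `q` gains the factor `q`.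
∣-1⇒product∣^product-1 : ∀ a (qs : List ℕ) → All (λ q → + q ℤ∣.∣ a - + 1) qs →
  + product qs ℤ∣.∣ a ℤ.^ product qs - + 1
∣-1⇒product∣^product-1 a [] [] = divides (a ℤ.^ 1 - + 1) (sym (ℤₚ.*-identityʳ (a ℤ.^ 1 - + 1)))
∣-1⇒product∣^product-1 a (q ∷ qs) (d ∷ ds) = subst (λ z → + (q ℕ.* P) ℤ∣.∣ z - + 1)
    (trans (ℤₚ.^-*-assoc a P q) (cong (a ℤ.^_) (ℕₚ.*-comm P q)))
    (∣-1⇒*∣^-1 q (∣-1⇒product∣^product-1 a qs ds) (∣-1⇒∣^-1 P d))
  where P = product qs

pos-^ : ∀ s j → + (s ℕ.^ j) ≡ (+ s) ℤ.^ j
pos-^ s zero    = refl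
pos-^ s (suc j) = trans (ℤₚ.pos-* s (s ℕ.^ j)) (cong (+ s *_) (pos-^ s j))

odd-form : ∀ m → ¬ 2 ℕ∣.∣ m → ∃ λ j → m ≡ suc (j ℕ.* 2)
odd-form m 2∤m with m ℕ.% 2 in eq | ℕDM.m%n<n m 2 | ℕDM.m≡m%n+[m/n]*n m 2
... | 0 | _ | e = ⊥-elim (2∤m (ℕ∣.divides (m ℕ./ 2) e))
... | 1 | _ | e = m ℕ./ 2 , e
... | suc (suc _) | s≤s (s≤s ()) | _

neg-^-odd : ∀ x j → (- x) ℤ.^ suc (j ℕ.* 2) ≡ - (x ℤ.^ suc (j ℕ.* 2))
neg-^-odd x zero    = sym (ℤₚ.neg-distribˡ-* x (+ 1))
neg-^-odd x (suc j) = trans (cong (λ z → - x * (- x * z)) (neg-^-odd x j)) (lem x (x ℤ.^ suc (j ℕ.* 2)))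
  where
  lem : ∀ x z → - x * (- x * - z) ≡ - (x * (x * z))
  lem = solve-∀

-- The previous lemma for -s, since (-s)^P = -(s^P) for the odd exponent P.
product∣^product+1 : ∀ s (qs : List ℕ) → ¬ 2 ℕ∣.∣ product qs → All (ℕ∣._∣ suc s) qs →
  product qs ℕ∣.∣ s ℕ.^ product qs ℕ.+ 1
product∣^product+1 s qs odd ds with odd-form (product qs) odd
... | j , e = ℤ∣.∣⇒∣ᵤ {+ product qs} {+ (s ℕ.^ product qs ℕ.+ 1)}
  (subst (+ product qs ℤ∣.∣_) neg (ℤ∣.∣m⇒∣-m (∣-1⇒product∣^product-1 (- + s) qs (All.map toNeg ds))))
  where
  toNeg : ∀ {q} → q ℕ∣.∣ suc s → + q ℤ∣.∣ - + s - + 1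
  toNeg {q} d = subst (+ q ℤ∣.∣_) (l (+ s)) (ℤ∣.∣m⇒∣-m (ℤ∣.∣ᵤ⇒∣ {+ q} {+ suc s} d))
    where
    l : ∀ s → - (+ 1 + s) ≡ - s - + 1
    l = solve-∀
  neg : - ((- + s) ℤ.^ product qs - + 1) ≡ + (s ℕ.^ product qs ℕ.+ 1)
  neg = trans (cong (λ z → - (z - + 1)) (subst (λ z → (- + s) ℤ.^ z ≡ - + (s ℕ.^ z)) (sym e)
          (trans (neg-^-odd (+ s) j) (cong -_ (sym (pos-^ s (suc (j ℕ.* 2)))))))) (l (+ (s ℕ.^ product qs)))
    where
    l : ∀ z → - (- z - + 1) ≡ z + + 1
    l = solve-∀

-- Existence and transfer of multiplicative orders.

least : ∀ {P : ℕ → Set} → Decidable P → ∀ k → P k → ∃ λ j → P j × (∀ i → P i → j ℕ.≤ i)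
least {P} P? = <-rec _ go
  where
  go : ∀ k → (∀ {i} → i ℕ.< k → P i → ∃ λ j → P j × (∀ i → P i → j ℕ.≤ i)) →
       P k → ∃ λ j → P j × (∀ i → P i → j ℕ.≤ i)
  go k rec pk with ℕₚ.anyUpTo? P? k
  ... | yes (i , i<k , pi) = rec i<k pi
  ... | no none = k , pk , λ i pi → ℕₚ.≮⇒≥ (λ i<k → none (i , i<k , pi))

prime∣^⇒∣ : ∀ {q} t → Prime q → ∀ j → q ℕ∣.∣ t ℕ.^ j → q ℕ∣.∣ t
prime∣^⇒∣ {q} t pq zero    d = ⊥-elim (¬prime[1] (subst Prime (ℕ∣.∣1⇒≡1 d) pq))
prime∣^⇒∣ t pq (suc j) d = [ id , prime∣^⇒∣ t pq j ]′ (euclidsLemma t (t ℕ.^ j) pq d)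

%≡⇒∣∸ : ∀ a b q .{{_ : NonZero q}} → a ℕ.% q ≡ b ℕ.% q → q ℕ∣.∣ a ℕ.∸ b
%≡⇒∣∸ a b q e = ℕ∣.divides (a ℕ./ q ℕ.∸ b ℕ./ q) (begin
  a ℕ.∸ b  ≡⟨ cong₂ ℕ._∸_ (ℕDM.m≡m%n+[m/n]*n a q) (ℕDM.m≡m%n+[m/n]*n b q) ⟩
  (a ℕ.% q ℕ.+ a ℕ./ q ℕ.* q) ℕ.∸ (b ℕ.% q ℕ.+ b ℕ./ q ℕ.* q) ≡⟨ cong (λ z → (z ℕ.+ a ℕ./ q ℕ.* q) ℕ.∸ (b ℕ.% q ℕ.+ b ℕ./ q ℕ.* q)) e ⟩
  (b ℕ.% q ℕ.+ a ℕ./ q ℕ.* q) ℕ.∸ (b ℕ.% q ℕ.+ b ℕ./ q ℕ.* q) ≡⟨ ℕₚ.[m+n]∸[m+o]≡n∸o (b ℕ.% q) _ _ ⟩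
  a ℕ./ q ℕ.* q ℕ.∸ b ℕ./ q ℕ.* q ≡⟨ ℕₚ.*-distribʳ-∸ q (a ℕ./ q) (b ℕ./ q) ⟨
  (a ℕ./ q ℕ.∸ b ℕ./ q) ℕ.* q ∎)
  where open ≡-Reasoning

-- Two of the powers t^0, ..., t^q agree modulo `q`. The smaller one is prime to `q` and cancels, so
-- some positive exponent works, and the least one is taken.
order-exists : ∀ t q → Prime q → ¬ q ℕ∣.∣ t → ∃ λ k → PrimeOrder t q k
order-exists t q pq q∤t with Finₚ.pigeonhole (ℕₚ.n<1+n q) (λ j → Fin.fromℕ< (ℕDM.m%n<n (t ℕ.^ toℕ j) q {{prime⇒nonZero pq}}))
... | i , j , i<j , fi≡fj = k , record
    { prime = pq ; 1≤k = proj₁ pk ; period = proj₂ pk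
    ; minimal = λ i 1≤i i<k d → ℕₚ.<⇒≱ i<k (k≤ i (1≤i , d)) }
  where
  instance _ = prime⇒nonZero pq
  P : ℕ → Set
  P k = 1 ℕ.≤ k × q ℕ∣.∣ t ℕ.^ k ℕ.∸ 1
  a = toℕ i
  b = toℕ j
  ta≡tb : t ℕ.^ b ℕ.% q ≡ t ℕ.^ a ℕ.% q
  ta≡tb = trans (sym (Finₚ.toℕ-fromℕ< _)) (trans (cong toℕ (sym fi≡fj)) (Finₚ.toℕ-fromℕ< _))
  factored : t ℕ.^ b ℕ.∸ t ℕ.^ a ≡ t ℕ.^ a ℕ.* (t ℕ.^ (b ℕ.∸ a) ℕ.∸ 1)
  factored = sym (trans (ℕₚ.*-distribˡ-∸ (t ℕ.^ a) (t ℕ.^ (b ℕ.∸ a)) 1) (cong₂ ℕ._∸_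
    (trans (sym (ℕₚ.^-distribˡ-+-* t a (b ℕ.∸ a))) (cong (t ℕ.^_) (ℕₚ.m+[n∸m]≡n (ℕₚ.<⇒≤ i<j)))) (ℕₚ.*-identityʳ (t ℕ.^ a))))
  found : P (b ℕ.∸ a)
  found = ℕₚ.m<n⇒0<n∸m i<j , [ (λ d → ⊥-elim (q∤t (prime∣^⇒∣ t pq a d))) , id ]′
    (euclidsLemma (t ℕ.^ a) _ pq (subst (q ℕ∣.∣_) factored (%≡⇒∣∸ (t ℕ.^ b) (t ℕ.^ a) q ta≡tb)))
  smallest = least (λ k → (1 ℕ.≤? k) ×-dec (q ℕ∣.∣? (t ℕ.^ k ℕ.∸ 1))) (b ℕ.∸ a) found
  k = proj₁ smallest
  pk = proj₁ (proj₂ smallest)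
  k≤ = proj₂ (proj₂ smallest)

∣-⇒∣^-^ : ∀ {d a b} j → d ℤ∣.∣ a - b → d ℤ∣.∣ a ℤ.^ j - b ℤ.^ j
∣-⇒∣^-^ zero    d∣ = divides (+ 0) refl
∣-⇒∣^-^ {d} {a} {b} (suc j) d∣ = subst (d ℤ∣.∣_) (lem a b (a ℤ.^ j) (b ℤ.^ j))
    (ℤ∣.∣m∣n⇒∣m+n (ℤ∣.∣n⇒∣m*n a (∣-⇒∣^-^ j d∣)) (ℤ∣.∣m⇒∣m*n (b ℤ.^ j) d∣))
  where
  lem : ∀ a b x y → a * (x - y) + (a - b) * y ≡ a * x - b * y
  lem = solve-∀

-- `t` and `τ` have congruent powers modulo `q`, so the same exponents give 1.
PrimeOrder⇒IsOrd : ∀ {t τ q k} → + q ℤ∣.∣ t - + τ → 1 ℕ.≤ τ → PrimeOrder τ q k → IsOrd q t k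
PrimeOrder⇒IsOrd {t} {τ} {q} {k} q∣t-τ 1≤τ po = 1≤k , ℤ∣.∣⇒∣ᵤ (to k period) ,
    λ j 1≤j d → ℕₚ.≮⇒≥ (λ j<k → minimal j 1≤j j<k (from j (ℤ∣.∣ᵤ⇒∣ d)))
  where
  open PrimeOrder po
  pred-^ : ∀ j → + (τ ℕ.^ j ℕ.∸ 1) ≡ (+ τ) ℤ.^ j - + 1
  pred-^ j = trans (l (+ (τ ℕ.^ j ℕ.∸ 1))) (cong (_- + 1) (trans (cong +_ (ℕₚ.m+[n∸m]≡n (ℕₚ.m^n>0 τ {{ℕ.>-nonZero 1≤τ}} j))) (pos-^ τ j)))
    where
    l : ∀ x → x ≡ + 1 + x - + 1
    l = solve-∀
  shift : ∀ x y → x - y + (y - + 1) ≡ x - + 1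
  shift = solve-∀
  to : ∀ j → q ℕ∣.∣ τ ℕ.^ j ℕ.∸ 1 → + q ℤ∣.∣ t ℤ.^ j - + 1
  to j d = subst (+ q ℤ∣.∣_) (shift (t ℤ.^ j) ((+ τ) ℤ.^ j)) (ℤ∣.∣m∣n⇒∣m+n (∣-⇒∣^-^ j q∣t-τ)
             (subst (+ q ℤ∣.∣_) (pred-^ j) (ℤ∣.∣ᵤ⇒∣ {+ q} {+ (τ ℕ.^ j ℕ.∸ 1)} d)))
  from : ∀ j → + q ℤ∣.∣ t ℤ.^ j - + 1 → q ℕ∣.∣ τ ℕ.^ j ℕ.∸ 1
  from j d = ℤ∣.∣⇒∣ᵤ {+ q} {+ (τ ℕ.^ j ℕ.∸ 1)} (subst (+ q ℤ∣.∣_) (sym (pred-^ j))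
    (ℤ∣.∣m+n∣m⇒∣n {m = t ℤ.^ j - (+ τ) ℤ.^ j} (subst (+ q ℤ∣.∣_) (sym (shift (t ℤ.^ j) ((+ τ) ℤ.^ j))) d) (∣-⇒∣^-^ j q∣t-τ)))

-- `q` divides t^(2h) - 1 = (t^h - 1)(t^h + 1), and minimality of the order excludes the first
-- factor.
half-order : ∀ {t q h} → 1 ℕ.≤ t → PrimeOrder t q (h ℕ.* 2) → q ℕ∣.∣ suc (t ℕ.^ h)
half-order {t} {q} {zero}  1≤t po with () ← PrimeOrder.1≤k po
half-order {t} {q} {h@(suc _)} 1≤t po = [ (λ d → ⊥-elim (minimal h (s≤s z≤n) (ℕₚ.m<m*n h 2 (s≤s (s≤s z≤n))) d)) , id ]′
    (euclidsLemma (t ℕ.^ h ℕ.∸ 1) (suc (t ℕ.^ h)) prime (subst (q ℕ∣.∣_) factored period))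
  where
  open PrimeOrder po
  r = t ℕ.^ h ℕ.∸ 1
  t^h : t ℕ.^ h ≡ suc r
  t^h = sym (ℕₚ.m+[n∸m]≡n (ℕₚ.m^n>0 t {{ℕ.>-nonZero 1≤t}} h))
  factored : t ℕ.^ (h ℕ.* 2) ℕ.∸ 1 ≡ r ℕ.* suc (t ℕ.^ h)
  factored = trans (cong (ℕ._∸ 1) (trans (sym (ℕₚ.^-*-assoc t h 2)) (cong (ℕ._^ 2) t^h)))
    (trans (cong (λ z → r ℕ.* 1 ℕ.+ z) (cong (r ℕ.*_) (cong suc (ℕₚ.*-identityʳ r)))) (trans (sym (ℕₚ.*-distribˡ-+ r 1 (suc r))) (cong (λ z → r ℕ.* suc z) (sym t^h))))

-- Descent along the prime factors, for an abstract function `e`.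

Differ : ℕ → ℕ → ℕ → Set
Differ k a b = a ≡ b ⊎ a ≡ b ℕ.+ k ⊎ b ≡ a ℕ.+ k

-- Two numbers in [0, 2k) differ by less than 2k, so `c` is -1, 0 or 1.
multiple-difference : ∀ {a b k} c → + a ≡ + b + c * + k → a ℕ.< k ℕ.+ k → b ℕ.< k ℕ.+ k → Differ k a b
multiple-difference {a} {b} {k} (+ c) e a< b< = go c (ℤₚ.+-injective (trans e (cong (_+_ (+ b)) (sym (ℤₚ.pos-* c k)))))
  where
  go : ∀ c → a ≡ b ℕ.+ c ℕ.* k → Differ k a b
  go 0 e = inj₁ (trans e (ℕₚ.+-identityʳ b))
  go 1 e = inj₂ (inj₁ (trans e (cong (b ℕ.+_) (ℕₚ.+-identityʳ k))))
  go (suc (suc c)) e = ⊥-elim (ℕₚ.<⇒≱ a< (subst (k ℕ.+ k ℕ.≤_) (sym e)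
    (ℕₚ.≤-trans (ℕₚ.+-monoʳ-≤ k (ℕₚ.m≤m+n k (c ℕ.* k))) (ℕₚ.m≤n+m _ b))))
multiple-difference {a} {b} {k} -[1+ c ] e a< b< = go c (ℤₚ.+-injective (trans (l (+ b) (+ k) (+ suc c)) (cong₂ _+_ (sym e) (sym (ℤₚ.pos-* (suc c) k)))))
  where
  l : ∀ b k c → b ≡ b + - c * k + c * k
  l = solve-∀
  go : ∀ c → b ≡ a ℕ.+ suc c ℕ.* k → Differ k a b
  go 0 e = inj₂ (inj₂ (trans e (cong (a ℕ.+_) (ℕₚ.+-identityʳ k))))
  go (suc c) e = ⊥-elim (ℕₚ.<⇒≱ b< (subst (k ℕ.+ k ℕ.≤_) (sym e)
    (ℕₚ.≤-trans (ℕₚ.+-monoʳ-≤ k (ℕₚ.m≤m+n k (c ℕ.* k))) (ℕₚ.m≤n+m _ a))))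

module Descent {D : Set} (q k : D → ℕ) (n : ℕ) (1≤n : 1 ℕ.≤ n) (n≤k : ∀ d → n ℕ.≤ k d)
  (e : ℕ → ℕ) (e<2n : ∀ m → e m ℕ.< n ℕ.+ n) (step : ∀ d m → Differ (k d) (e m) (e (m ℕ.* q d))) where

  Π : List D → ℕ
  Π ds = product (map q ds)

  k≢0 : ∀ d → k d ≢ 0
  k≢0 d kd≡0 = ℕₚ.<⇒≱ 1≤n (subst (n ℕ.≤_) kd≡0 (n≤k d))

  too-big : ∀ {a b m} → n ℕ.≤ a → n ℕ.≤ b → e m ≢ a ℕ.+ b
  too-big {m = m} n≤a n≤b em = ℕₚ.<⇒≱ (e<2n m) (subst (n ℕ.+ n ℕ.≤_) (sym em) (ℕₚ.+-mono-≤ n≤a n≤b))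

  -- Crossing `d` backwards, 0 becomes 0 or `k d`. From a later value `k r`, adding `k d` would
  -- reach 2n, while subtracting it leaves only 0, because sorting gives `k r` ≤ `k d`.
  values-sorted : ∀ ds → AllPairs (λ a b → k b ℕ.≤ k a) ds → ∀ m → e (m ℕ.* Π ds) ≡ 0 →
    e m ≡ 0 ⊎ ∃ λ r → r ∈ ds × e m ≡ k r
  values-sorted [] [] m z = inj₁ (trans (cong e (sym (ℕₚ.*-identityʳ m))) z)
  values-sorted (d ∷ ds) (max ∷ sorted) m z
    with values-sorted ds sorted (m ℕ.* q d) (trans (cong e (ℕₚ.*-assoc m (q d) (Π ds))) z) | step d m
  ... | inj₁ z′ | inj₁ s = inj₁ (trans s z′)
  ... | inj₁ z′ | inj₂ (inj₁ s) = inj₂ (d , here refl , trans s (cong (ℕ._+ k d) z′))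
  ... | inj₁ z′ | inj₂ (inj₂ s) = ⊥-elim (k≢0 d (ℕₚ.m+n≡0⇒n≡0 (e m) (trans (sym s) z′)))
  ... | inj₂ (r , r∈ , er) | inj₁ s = inj₂ (r , there r∈ , trans s er)
  ... | inj₂ (r , r∈ , er) | inj₂ (inj₁ s) = ⊥-elim (too-big (n≤k r) (n≤k d) (trans s (cong (ℕ._+ k d) er)))
  ... | inj₂ (r , r∈ , er) | inj₂ (inj₂ s) = inj₁ (ℕₚ.n≤0⇒n≡0 (ℕₚ.+-cancelʳ-≤ (k d) (e m) 0
          (subst (ℕ._≤ k d) (trans (sym er) s) (All.lookup max r∈))))

  -- Only the product of the list enters, so the list may first be sorted by decreasing `k`.
  values : ∀ ds m → e (m ℕ.* Π ds) ≡ 0 → e m ≡ 0 ⊎ ∃ λ r → r ∈ ds × e m ≡ k r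
  values ds m z with values-sorted (sort ds)
      (Linked⇒AllPairs (λ p q → ℕₚ.≤-trans q p) (sort-↗ ds)) m
      (trans (cong (λ z → e (m ℕ.* z)) (product-↭ (map⁺ q (sort-↭ ds)))) z)
    where open Sort (Flip.decTotalOrder (On.decTotalOrder ℕₚ.≤-decTotalOrder k))
  ... | inj₁ z′ = inj₁ z′
  ... | inj₂ (r , r∈ , er) = inj₂ (r , ∈-resp-↭ (sort-↭ ds) r∈ , er)
    where open Sort (Flip.decTotalOrder (On.decTotalOrder ℕₚ.≤-decTotalOrder k))

  -- A factorisation of `w` whose cofactor to `m` uses only primes of order `K`, with the value `K`
  -- already attained at `m`.
  Isolated : ℕ → ℕ → Set
  Isolated K w = ∃ λ m → ∃ λ bs → All (λ b → k b ≡ K) bs × m ℕ.* Π bs ≡ w × e m ≡ K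

  -- Primes of order `K` are set aside in `bs`; the others are absorbed into `m`. Absorbing `d`
  -- preserves the value `K`: a rise would reach 2n, and a drop would make `K` equal to `k d` or to
  -- some `k r` + `k d`, which is at least 2n.
  isolate : ∀ K → n ℕ.≤ K → ∀ ds bs m → All (λ b → k b ≡ K) bs → e (m ℕ.* (Π ds ℕ.* Π bs)) ≡ 0 → e m ≡ K →
    Isolated K (m ℕ.* (Π ds ℕ.* Π bs))
  isolate K n≤K [] bs m all z em = m , bs , all , cong (m ℕ.*_) (sym (ℕₚ.*-identityˡ (Π bs))) , em
  isolate K n≤K (d ∷ ds) bs m all z em with k d ℕ.≟ K
  ... | yes kd = subst (Isolated K) move (isolate K n≤K ds (d ∷ bs) m (kd ∷ all) (trans (cong e move) z) em)
    where
    move : m ℕ.* (Π ds ℕ.* (q d ℕ.* Π bs)) ≡ m ℕ.* (q d ℕ.* Π ds ℕ.* Π bs)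
    move = cong (m ℕ.*_) (trans (sym (ℕₚ.*-assoc (Π ds) (q d) (Π bs))) (cong (ℕ._* Π bs) (ℕₚ.*-comm (Π ds) (q d))))
  ... | no k≢K = subst (Isolated K) move (isolate K n≤K ds bs (m ℕ.* q d) all z′ e≡K)
    where
    move : m ℕ.* q d ℕ.* (Π ds ℕ.* Π bs) ≡ m ℕ.* (q d ℕ.* Π ds ℕ.* Π bs)
    move = trans (ℕₚ.*-assoc m (q d) _) (cong (m ℕ.*_) (sym (ℕₚ.*-assoc (q d) (Π ds) (Π bs))))
    z′ : e (m ℕ.* q d ℕ.* (Π ds ℕ.* Π bs)) ≡ 0
    z′ = trans (cong e move) z
    e≡K : e (m ℕ.* q d) ≡ K
    -- All remaining factors, including those set aside, are needed to reach the point where `e` is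
    -- 0.
    e≡K with values (ds ++ bs) (m ℕ.* q d) (trans (cong (λ z → e (m ℕ.* q d ℕ.* z))
              (trans (cong product (map-++ q ds bs)) (product-++ (map q ds) (map q bs)))) z′) | step d m
    ... | _ | inj₁ s = trans (sym s) em
    ... | inj₁ e≡0 | inj₂ (inj₁ s) = ⊥-elim (k≢K (trans (trans (cong (ℕ._+ k d) (sym e≡0)) (sym s)) em))
    ... | inj₂ (r , _ , er) | inj₂ (inj₁ s) = ⊥-elim (too-big (n≤k r) (n≤k d) (trans s (cong (ℕ._+ k d) er)))
    ... | _ | inj₂ (inj₂ s) = ⊥-elim (too-big n≤K (n≤k d) (trans s (cong (ℕ._+ k d) em)))

-- Dictionary between the definitions on elements and the index form.

module _ (F : FinAbGroup) where
  open Group F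
  open FinAbGroup F using (enum; ε; reflexive; ⁻¹-cong) renaming (trans to ≈-trans; sym to ≈-sym; _≟_ to _≈?_)

  δ≡[≟] : ∀ g h → δ F g h ≡ [ index g ≟ index h ]
  δ≡[≟] g h with g ≈? h
  ... | yes e = sym (⟦⟧-yes (index g Fin.≟ index h) (index-cong e))
  ... | no ¬e = sym (⟦⟧-no (index g Fin.≟ index h) (¬e ∘ index-injective))

  δ-enumʳ : ∀ g i → δ F g (enum i) ≡ [ index g ≟ i ]
  δ-enumʳ g i = trans (δ≡[≟] g (enum i)) (cong [ index g ≟_] (index-enum i))

  δ-enumˡ : ∀ i → δ F (enum i) ε ≡ [ o ≟ i ]
  δ-enumˡ i = trans (δ≡[≟] (enum i) ε) (trans (cong [_≟ o ] (index-enum i)) ([≟]-sym i o))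

  index-powℕ : ∀ k i → index (powℕ F (enum i) k) ≡ pow k i
  index-powℕ k i = cong index (powℕ≡· (enum i) k)

  -- Cases on the signs of `t` and `c`. For negative `t` the multiple `c` is negative too, and τ +
  -- |t| = |c| v, so the power `τ` inverts the power |t|.
  index-powℤ : ∀ {t τ} c → t ≡ + τ + c * + v → ∀ i → index (powℤ F (enum i) t) ≡ pow τ i
  index-powℤ {+ a} {τ} (+ d) e i = trans (index-powℕ a i) (pow-cong-mod {a} {τ} 0 d
    (trans (ℕₚ.+-identityʳ a) (ℤₚ.+-injective (trans e (cong (_+_ (+ τ)) (sym (ℤₚ.pos-* d v)))))) i)
  index-powℤ {+ a} {τ} -[1+ d ] e i = trans (index-powℕ a i) (pow-cong-mod {a} {τ} (suc d) 0
    (ℤₚ.+-injective (trans (cong (_+_ (+ a)) (ℤₚ.pos-* (suc d) v)) (trans (cong (_+ + suc d * + v) e)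
      (trans (l (+ τ) (+ suc d) (+ v)) (cong +_ (sym (ℕₚ.+-identityʳ τ))))))) i)
    where
    l : ∀ τ c v → τ + - c * v + c * v ≡ τ
    l = solve-∀
  index-powℤ { -[1+ a ]} {τ} (+ d) e i with () ← trans e (cong (_+_ (+ τ)) (sym (ℤₚ.pos-* d v)))
  index-powℤ { -[1+ a ]} {τ} -[1+ d ] e i = trans (index-cong (⁻¹-cong (≈-trans
      (reflexive (powℕ≡· (enum i) (suc a))) (≈-sym (enum-pow (suc a) i)))))
      (sym (pow-inv τ (suc a) (suc d) (ℤₚ.+-injective (trans (l (+ τ) (+ suc a) (+ suc d) (+ v) e) (sym (ℤₚ.pos-* (suc d) v)))) i))
    where
    l : ∀ τ a c v → - a ≡ τ + - c * v → τ + a ≡ c * v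
    l τ a c v e = trans (l₁ τ a) (trans (cong (λ z → τ - z) e) (l₂ τ c v))
      where
      l₁ : ∀ τ a → τ + a ≡ τ - - a
      l₁ = solve-∀
      l₂ : ∀ τ c v → τ - (τ + - c * v) ≡ c * v
      l₂ = solve-∀

  twist≗push : ∀ s (φ : Fin v → Fin v) → (∀ i → index (powℤ F (enum i) s) ≡ φ i) → ∀ X → twist F s X ≗ push φ X
  twist≗push s φ e X i = sum-cong (λ j → cong (X j *_) (trans (δ-enumʳ _ i) (cong [_≟ i ] (e j))))

  coeff1≡ : ∀ X → coeff1 F X ≡ X o
  coeff1≡ X = trans (sum-cong (λ i → cong (X i *_) (δ-enumˡ i))) (sum-pick X o)

-- A positive representative of the multiplier and the list of prime factors.

record Representative (t : ℤ) (v : ℕ) : Set where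
  field
    τ         : ℕ
    1≤τ       : 1 ℕ.≤ τ
    c         : ℤ
    congruent : t ≡ + τ + c * + v

representative : ∀ t v → .{{_ : NonZero v}} → Representative t v
representative t v = record
  -- Adding `v` to the remainder keeps `τ` positive even when the remainder is 0.
  { τ = t ℤ.%ℕ v ℕ.+ v ; 1≤τ = ℕₚ.≤-trans (ℕ.>-nonZero⁻¹ v) (ℕₚ.m≤n+m v _) ; c = t ℤ./ℕ v - + 1
  ; congruent = trans (ℤDM.a≡a%ℕn+[a/ℕn]*n t v) (l (+ (t ℤ.%ℕ v)) (t ℤ./ℕ v) (+ v)) }
  where
  l : ∀ r d v → r + d * v ≡ r + v + (d - + 1) * v
  l = solve-∀

record Datum (t v : ℕ) : Set where
  field
    q k   : ℕ
    order : PrimeOrder t q k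
    q∣v   : q ∣ v

collect : ∀ {t v} → Coprime t v → ∀ qs → All Prime qs → All (_∣ v) qs → ∃ λ (ds : List (Datum t v)) → map Datum.q ds ≡ qs
collect cop [] [] [] = [] , refl
collect {t} {v} cop (q ∷ qs) (pq ∷ pqs) (d ∷ ds) with order-exists t q pq
      (λ q∣t → ¬prime[1] (subst Prime (cop (q∣t , d)) pq)) | collect cop qs pqs ds
... | k , po | data′ , e = record { q = q ; k = k ; order = po ; q∣v = d } ∷ data′ , cong (q ∷_) e

-- The primes are listed with multiplicity, so that the descent ends exactly at `v`.
all-data : ∀ {t v} → .{{_ : NonZero v}} → Coprime t v → ∃ λ (ds : List (Datum t v)) → product (map Datum.q ds) ≡ v
all-data {t} {v} cop with collect cop factors factorsPrime (All.tabulate (λ q∈ → subst (_ ∣_) (sym isFactorisation) (∈⇒∣product q∈)))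
  where open PrimeFactorisation (factorise v)
... | ds , e = ds , trans (cong product e) (sym (PrimeFactorisation.isFactorisation (factorise v)))

prime[2] : Prime 2
prime[2] = toWitness {a? = prime? 2} _

-- The argument for a positive natural multiplier.

module Proof (F : FinAbGroup) (t n : ℕ) (t-coprime : Coprime t (FinAbGroup.size F)) (1≤t : 1 ℕ.≤ t) (1≤n : 1 ℕ.≤ n)
  (X : ZG F) where
  open Group F
  open Multiplier F t n t-coprime 1≤t 1≤n
  open Datum

  module _ (good : Good X)
    (orders : ∀ {q k} → q ∣ v → PrimeOrder t q k → (+ n ℤ.⊔ (+ n - X o)) ℤ.< + k ⊎ n ℕ.≤ k × 2 ∣ k) where

    instance
      v≢0 : NonZero v
      v≢0 = Finₚ.nonZeroIndex o

    Y : ℕ → Fin v → ℤ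
    Y m = push (pow m) X

    good-Y : ∀ m → Good (Y m)
    good-Y m = push-good m good

    Y-* : ∀ m q → push (pow q) (Y m) ≗ Y (m ℕ.* q)
    Y-* m q i = trans (push-∘ (pow q) (pow m) X i)
      (push-congˡ X (λ j → trans (pow-∘ q m j) (cong (λ z → pow z j) (ℕₚ.*-comm q m))) i)

    abstract
      e : ℕ → ℕ
      e m = proj₁ (Good.deficiency (good-Y m))

      Y+e : ∀ m → Y m o + + e m ≡ + n
      Y+e m = proj₁ (proj₂ (Good.deficiency (good-Y m)))

      e<2n : ∀ m → e m ℕ.< n ℕ.+ n
      e<2n m = proj₂ (proj₂ (Good.deficiency (good-Y m)))

    e-from-Y : ∀ m m′ c k → Y m′ o ≡ Y m o + c * + k → + e m ≡ + e m′ + c * + k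
    e-from-Y m m′ c k eq = begin
      + e m                                  ≡⟨ l₁ (Y m o) (+ e m) ⟩
      Y m o + + e m - Y m o                  ≡⟨ cong (_- Y m o) (trans (Y+e m) (sym (Y+e m′))) ⟩
      Y m′ o + + e m′ - Y m o                ≡⟨ cong (λ z → z + + e m′ - Y m o) eq ⟩
      Y m o + c * + k + + e m′ - Y m o       ≡⟨ l₂ (Y m o) (c * + k) (+ e m′) ⟩
      + e m′ + c * + k                       ∎
      where
      open ≡-Reasoning
      l₁ : ∀ y e → e ≡ y + e - y
      l₁ = solve-∀
      l₂ : ∀ y c e → y + c + e - y ≡ e + c
      l₂ = solve-∀

    n≤k : ∀ (d : Datum t v) → n ℕ.≤ k d
    n≤k d with orders (q∣v d) (order d)
    ... | inj₁ l = ℤₚ.drop‿+≤+ (ℤₚ.≤-trans (ℤₚ.i≤i⊔j (+ n) (+ n - X o)) (ℤₚ.<⇒≤ l))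
    ... | inj₂ (l , _) = l

    e<2k : ∀ (d : Datum t v) m → e m ℕ.< k d ℕ.+ k d
    e<2k d m = ℕₚ.<-≤-trans (e<2n m) (ℕₚ.+-mono-≤ (n≤k d) (n≤k d))

    e-step : ∀ (d : Datum t v) m → Differ (k d) (e m) (e (m ℕ.* q d))
    e-step d m = multiple-difference c (e-from-Y m (m ℕ.* q d) c (k d) (trans (sym (Y-* m (q d) o)) (proj₂ change)))
                   (e<2k d m) (e<2k d (m ℕ.* q d))
      where
      change = step (order d) (good-Y m)
      c = proj₁ change

    open Descent q k n 1≤n n≤k e e<2n e-step

    -- The power `v` sends everything to the identity, where the whole coefficient sum `n` collects.
    e-v : e v ≡ 0
    e-v = ℤₚ.+-injective (trans (l (Y v o) (+ e v)) (trans (cong₂ _-_ (Y+e v) Yv) (ℤₚ.+-inverseʳ (+ n))))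
      where
      l : ∀ y e → e ≡ y + e - y
      l = solve-∀
      Yv : Y v o ≡ + n
      Yv = trans (sum-cong (λ j → trans (cong (X j *_) (⟦⟧-yes (pow v j Fin.≟ o) (pow-v j))) (ℤₚ.*-identityʳ (X j))))
             (Good.augment good)

    Real : ℕ → Set
    Real m = push inv (Y m) ≗ Y m

    -- If 2 divides `v`, then `t` is odd and has order 1 modulo 2, which is neither greater than `n`
    -- nor even.
    v-odd : ¬ 2 ∣ v
    v-odd 2∣v with order-exists t 2 prime[2] 2∤t
      where
      2∤t : ¬ 2 ∣ t
      2∤t 2∣t with () ← t-coprime (2∣t , 2∣v)
    ... | k₂ , po = [ (λ l → ℕₚ.<⇒≱ (ℤₚ.drop‿+<+ (ℤₚ.≤-<-trans (ℤₚ.i≤i⊔j (+ n) (+ n - X o)) l)) (ℕₚ.≤-trans k₂≤1 1≤n)) ,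
                      (λ (_ , d) → ℕₚ.<⇒≱ (s≤s k₂≤1) (ℕ∣.∣⇒≤ {{ℕ.>-nonZero (PrimeOrder.1≤k po)}} d)) ]′ (orders 2∣v po)
      where
      2∣t-1 : 2 ∣ t ℕ.^ 1 ℕ.∸ 1
      2∣t-1 with odd-form t (λ 2∣t → ℕₚ.1+n≢n (t-coprime (2∣t , 2∣v)))
      ... | j , refl = ℕ∣.divides j (ℕₚ.*-identityʳ (j ℕ.* 2))
      k₂≤1 : k₂ ℕ.≤ 1
      k₂≤1 = ℕₚ.≮⇒≥ (λ 1<k → PrimeOrder.minimal po 1 (s≤s z≤n) 1<k 2∣t-1)

    2-coprime-v : Coprime 2 v
    2-coprime-v (d∣2 , d∣v) with prime⇒irreducible prime[2] d∣2
    ... | inj₁ d≡1  = d≡1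
    ... | inj₂ refl = ⊥-elim (v-odd d∣v)

    real-* : ∀ m q → Real m → Real (m ℕ.* q)
    real-* m q real i = begin
      push inv (Y (m ℕ.* q)) i            ≡⟨ push-congʳ inv (Y-* m q) i ⟨
      push inv (push (pow q) (Y m)) i     ≡⟨ push-∘ inv (pow q) (Y m) i ⟩
      push (inv ∘ pow q) (Y m) i          ≡⟨ push-congˡ (Y m) (inv-pow q) i ⟩
      push (pow q ∘ inv) (Y m) i          ≡⟨ push-∘ (pow q) inv (Y m) i ⟨
      push (pow q) (push inv (Y m)) i     ≡⟨ push-congʳ (pow q) real i ⟩
      push (pow q) (Y m) i                ≡⟨ Y-* m q i ⟩
      Y (m ℕ.* q) i                       ∎
      where open ≡-Reasoning

    -- Reality passes from `Y m` to its powers and makes the coefficients off the identity even.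
    -- Each step then changes `e` by a multiple of 2k, while `e` stays in [0, 2k).
    real⇒e-constant : ∀ (bs : List (Datum t v)) m → Real m → e m ≡ e (m ℕ.* Π bs)
    real⇒e-constant []       m real = cong e (sym (ℕₚ.*-identityʳ m))
    real⇒e-constant (b ∷ bs) m real = trans single (trans
        (real⇒e-constant bs (m ℕ.* q b) (real-* m (q b) real)) (cong e (ℕₚ.*-assoc m (q b) (Π bs))))
      where
      K = k b ℕ.+ k b
      -- This weaker bound meets the hypothesis of `multiple-difference` for the modulus `K`;
      -- `too-far` then uses the bound by `K` itself.
      e<K+K : ∀ m → e m ℕ.< K ℕ.+ K
      e<K+K m = ℕₚ.<-≤-trans (e<2k b m) (ℕₚ.m≤m+n K K)
      change = step-even (order b) (good-Y m) (real⇒even 2-coprime-v (good-Y m) real)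
      c = proj₁ change
      too-far : ∀ m x → e m ≢ x ℕ.+ K
      too-far m x s = ℕₚ.<⇒≱ (e<2k b m) (subst (K ℕ.≤_) (sym s) (ℕₚ.m≤n+m K x))
      single : e m ≡ e (m ℕ.* q b)
      single = [ id , [ ⊥-elim ∘ too-far m (e (m ℕ.* q b)) , ⊥-elim ∘ too-far (m ℕ.* q b) (e m) ]′ ]′
        (multiple-difference c (e-from-Y m (m ℕ.* q b) c K (trans (sym (Y-* m (q b) o)) (proj₂ change)))
          (e<K+K m) (e<K+K (m ℕ.* q b)))

    -- By `half-order`, t^h is -1 modulo every prime in `bs`, so t^N is -1 modulo their odd product,
    -- which is `v` divided by `m`. After `pow m`, the power t^N therefore acts as inversion, and it
    -- fixes `Y m`.
    real : ∀ h m (bs : List (Datum t v)) → m ℕ.* Π bs ≡ v → All (λ b → k b ≡ h ℕ.* 2) bs → Real m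
    real h m bs mΠ≡v all i = begin
      push inv (Y m) i                       ≡⟨ push-∘ inv (pow m) X i ⟩
      push (inv ∘ pow m) X i                 ≡⟨ push-congˡ X (λ j → sym (trans (pow-∘ (t ℕ.^ N) m j) (negate j))) i ⟩
      push (pow (t ℕ.^ N) ∘ pow m) X i       ≡⟨ push-∘ (pow (t ℕ.^ N)) (pow m) X i ⟨
      push (pow (t ℕ.^ N)) (Y m) i           ≡⟨ multiplier-^ (good-Y m) N i ⟩
      Y m i                                  ∎
      where
      open ≡-Reasoning
      N = h ℕ.* Π bs
      P∣ : Π bs ∣ t ℕ.^ N ℕ.+ 1
      P∣ = subst (λ z → Π bs ∣ z ℕ.+ 1) (ℕₚ.^-*-assoc t h (Π bs)) (product∣^product+1 (t ℕ.^ h) (map q bs)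
             (λ 2∣P → v-odd (ℕ∣.∣-trans 2∣P (ℕ∣.divides m (sym mΠ≡v))))
             (Allₚ.map⁺ (All.map (λ {b} kb → half-order {h = h} 1≤t (subst (PrimeOrder t (q b)) kb (order b))) all)))
      negate : ∀ j → pow (t ℕ.^ N ℕ.* m) j ≡ inv (pow m j)
      negate = pow-inv (t ℕ.^ N ℕ.* m) m (ℕ∣.quotient P∣) (begin
        t ℕ.^ N ℕ.* m ℕ.+ m                ≡⟨ cong (t ℕ.^ N ℕ.* m ℕ.+_) (ℕₚ.*-identityˡ m) ⟨
        t ℕ.^ N ℕ.* m ℕ.+ 1 ℕ.* m          ≡⟨ ℕₚ.*-distribʳ-+ m (t ℕ.^ N) 1 ⟨
        (t ℕ.^ N ℕ.+ 1) ℕ.* m              ≡⟨ cong (ℕ._* m) (_∣_.equality P∣) ⟩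
        ℕ∣.quotient P∣ ℕ.* Π bs ℕ.* m      ≡⟨ ℕₚ.*-assoc (ℕ∣.quotient P∣) (Π bs) m ⟩
        ℕ∣.quotient P∣ ℕ.* (Π bs ℕ.* m)    ≡⟨ cong (ℕ∣.quotient P∣ ℕ.*_) (trans (ℕₚ.*-comm (Π bs) m) mΠ≡v) ⟩
        ℕ∣.quotient P∣ ℕ.* v               ∎)

    Y1 : Y 1 ≗ X
    Y1 = push-id pow-1 X

    n-Xo≡e1 : + n - X o ≡ + e 1
    n-Xo≡e1 = trans (cong (_- X o) (sym (trans (cong (_+ + e 1) (sym (Y1 o))) (Y+e 1)))) (l (X o) (+ e 1))
      where
      l : ∀ x e → x + e - x ≡ e
      l = solve-∀

    -- Isolating the order `k r` yields `m` with `Y m` real and `e m` equal to `k r`. Constancy of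
    -- `e` from `m` to `v` makes this 0, against `k≢0`.
    not-even-order : ∀ r (ds : List (Datum t v)) → Π ds ≡ v → 2 ∣ k r → e 1 ≢ k r
    not-even-order r ds Π≡v (ℕ∣.divides h kr) er = contra (isolate (k r) (n≤k r) ds [] 1 [] (trans (cong e 1ΠΠ≡v) e-v) er)
      where
      1ΠΠ≡v : 1 ℕ.* (Π ds ℕ.* 1) ≡ v
      1ΠΠ≡v = trans (ℕₚ.*-identityˡ _) (trans (ℕₚ.*-identityʳ _) Π≡v)
      contra : ¬ Isolated (k r) (1 ℕ.* (Π ds ℕ.* 1))
      contra (m , bs , all , mΠ , em) = k≢0 r (trans (sym em) (trans
          (real⇒e-constant bs m (real h m bs mΠ≡v (All.map (λ kb → trans kb kr) all))) (trans (cong e mΠ≡v) e-v)))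
        where mΠ≡v = trans mΠ 1ΠΠ≡v

    -- Otherwise `e 1` is some `k r`. Since `e 1` is n - a_0, condition (1) fails for that prime,
    -- and condition (2) is excluded by `not-even-order`.
    e-1 : e 1 ≡ 0
    e-1 = [ id , ⊥-elim ∘ impossible ]′ (values ds 1 (trans (cong e (trans (ℕₚ.*-identityˡ _) Π≡v)) e-v))
      where
      ds = proj₁ (all-data t-coprime)
      Π≡v = proj₂ (all-data t-coprime)
      impossible : ¬ ∃ λ r → r ∈ ds × e 1 ≡ k r
      impossible (r , _ , er) = [ (λ l → ℤₚ.<⇒≱ (ℤₚ.≤-<-trans (ℤₚ.i≤j⊔i (+ n) (+ n - X o)) l)
                                    (ℤₚ.≤-reflexive (sym (trans n-Xo≡e1 (cong +_ er))))) ,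
                                  (λ (_ , 2∣k) → not-even-order r ds Π≡v 2∣k er) ]′ (orders (q∣v r) (order r))

    Xo≡n : X o ≡ + n
    Xo≡n = trans (sym (Y1 o)) (trans (sym (ℤₚ.+-identityʳ _)) (trans (cong (λ z → Y 1 o + + z) (sym e-1)) (Y+e 1)))

    conclusion : ∀ i → X i ≡ + n * [ o ≟ i ]
    conclusion i = trans (Good.extremal good (cong ∣_∣ Xo≡n) i) (cong (_* [ o ≟ i ]) Xo≡n)

-- Transfer to an arbitrary integer multiplier and the original definitions.

theorem14 : (F : FinAbGroup) → (t : ℤ) → Coprime ℤ.∣ t ∣ (FinAbGroup.size F) →
    (X : ZG F) → (n : ℕ) → 1 ℕ.≤ n →
    _≡ᴳ_ F (twist F t X) X →
    aug F X ≡ + n →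
    _≡ᴳ_ F (mul F X (twist F (ℤ.- + 1) X)) (scalar F (+ (n ℕ.* n))) →
    (∀ (q : ℕ) → Prime q → q ∣ FinAbGroup.size F → ∀ (k : ℕ) → IsOrd q t k →
    ((+ k) ℤ.> (+ n ℤ.⊔ (+ n ℤ.- coeff1 F X)))
    ⊎ ((n ℕ.≤ k) × (2 ∣ k))) →
    _≡ᴳ_ F X (scalar F (+ n))
theorem14 F t t-coprime X n 1≤n fixed augment norm orders i =
    trans (Proof.conclusion F τ n τ-coprime 1≤τ 1≤n X good orders′ i) (cong (+ n *_) (sym (δ-enumˡ F i)))
  where
  open Group F
  open Representative (representative t v {{Finₚ.nonZeroIndex o}})
  τ≡t : ∀ {d} → d ∣ v → + d ℤ∣.∣ t - + τ
  τ≡t {d} d∣v = subst (+ d ℤ∣.∣_) (sym (trans (cong (_- + τ) congruent) (l (+ τ) (c * + v))))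
                  (ℤ∣.∣n⇒∣m*n c (ℤ∣.∣ᵤ⇒∣ {+ d} {+ v} d∣v))
    where
    l : ∀ τ x → τ + x - τ ≡ x
    l = solve-∀
  τ-coprime : Coprime τ v
  τ-coprime {d} (d∣τ , d∣v) = t-coprime (ℤ∣.∣⇒∣ᵤ (subst (+ d ℤ∣.∣_) (l t (+ τ))
      (ℤ∣.∣m∣n⇒∣m+n (τ≡t d∣v) (ℤ∣.∣ᵤ⇒∣ {+ d} {+ τ} d∣τ))) , d∣v)
    where
    l : ∀ t τ → t - τ + τ ≡ t
    l = solve-∀
  open Multiplier F τ n τ-coprime 1≤τ 1≤n using (Good; conv)
  inverse : twist F (ℤ.- + 1) X ≗ push inv X
  inverse = twist≗push F (ℤ.- + 1) inv (λ j → index-cong (FinAbGroup.⁻¹-cong F (FinAbGroup.identityʳ F _))) X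
  good : Good X
  good = record
    { multiplier = λ i → trans (sym (twist≗push F t (pow τ) (index-powℤ F c congruent) X i)) (fixed i)
    ; augment    = augment
    ; norm       = λ i → trans (sym (mul≡conv i)) (trans (norm i) (cong (+ (n ℕ.* n) *_) (δ-enumˡ F i)))
    }
    where
    -- Adjointness moves the inversion of the second factor onto its group element, turning products
    -- into quotients.
    mul≡conv : ∀ i → mul F X (twist F (ℤ.- + 1) X) i ≡ conv X i
    mul≡conv i = sum-cong (λ j → trans (trans
        (sum-cong (λ k → trans (cong₂ (λ a b → X j * a * b) (inverse k) (δ-enumʳ F _ i)) (ℤₚ.*-assoc (X j) (push inv X k) _)))
        (sum-*ˡ (X j) (λ k → push inv X k * [ j ⊗ k ≟ i ])))
      (cong (X j *_) (push-adjoint inv X (λ k → [ j ⊗ k ≟ i ]))))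
  orders′ : ∀ {q k} → q ∣ v → PrimeOrder τ q k → (+ n ℤ.⊔ (+ n - X o)) ℤ.< + k ⊎ n ℕ.≤ k × 2 ∣ k
  orders′ {q} {k} q∣v po = [ (λ l → inj₁ (subst (λ z → (+ n ℤ.⊔ (+ n - z)) ℤ.< + k) (coeff1≡ F X) l)) , inj₂ ]′
    (orders q (PrimeOrder.prime po) q∣v k (PrimeOrder⇒IsOrd (τ≡t q∣v) 1≤τ po))
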